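{- Let $w$ be a binary word with $|w|>7$, and let $n_i\ge 1$ denote positive integers. Then all elements of $\mathtt{BR}(w)$ are rich: (1) for $l(w)=8$ iff $w=abababab$; (2) for $l(w)=7$ iff $w$ is $ababab^2a$, $abab^2aba$ or $ab^2ababa$; (3) for $l(w)=6$ iff $w\in\{u,(u^c)^R : u\in T\}$ where $T=\{ab^2aba^2b,\ abab^2a^2b,\ ababa^2b^2,\ a^2bab^2ab,\ a^2babab^2,\ aba^2b^2ab,\ a^{n_1}babab \mid n_1\ge 3\}$; (4) for $l(w)=5$ iff $w$ is $a^{n_1}ba^{n_3}ba^{n_5}$, or one of $ab^{n_2}ab^{n_4}a^2$, $a^2b^{n_2}ab^{n_4}a$, $ab^{n_2}a^2b^{n_4}a$ with $n_2+n_4=4$; (5) for $l(w)=4$ iff $w$ is $ab^{n_2}ab^{n_4}$ or $a^{n_1}ba^{n_3}b$ or $w\in S$, where $S=\{a^{n_1}b^{n_2}a^{n_3}b^{n_4} \mid (n_2,n_4),(n_1,n_3)\in\{(3,1),(2,2),(1,3)\}\}$; (6) for $l(w)=3$ iff $w$ is one of $a^2b^4a^2$, $ab^{n_2}a$, $a^{n_1}ba^{n_3}$, $a^{n_1}b^2a^{n_3}$, or $ab^{n_2}a^{n_3}$, $a^{n_1}b^{n_2}a$ with $n_2\in\{3,4\}$ and $n_1,n_3\ge 3$.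
   Context: A binary word is a word over a two-letter alphabet $\Sigma=\{a,b\}$ in which both letters occur; the alphabet is unordered, i.e. $a$ and $b$ stand for the two letters in either order (statements are understood up to exchanging the two letters). For a non-empty word, its run-length encoding is $c_1^{n_1}\cdots c_k^{n_k}$ with $c_i\ne c_{i+1}$, $n_i\ge1$; $l(w)=k$ is the length of the run sequence. $u^R$ is the reversal of $u$; $u^c$ is the complement of $u$, obtained by applying the morphism $a\mapsto b$, $b\mapsto a$. $\mathtt{BR}(w)=\{B_t\cdots B_1 : w=B_1\cdots B_t,\ t\ge1,\ B_i \text{ non-empty}\}$. A word $w$ is rich if it has exactly $|w|$ distinct non-empty palindromic factors. -}

module Defs where

open import Data.Nat using (ℕ; zero; suc; _+_; _≤_; _<_)
open import Data.Product using (Σ; ∃; ∃-syntax; _×_; _,_)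
open import Data.Sum using (_⊎_)
open import Data.List using (List; []; _∷_; _++_; length; reverse; map; concat; replicate)
open import Data.List.Relation.Unary.All using (All)
open import Data.List.Relation.Unary.Unique.Propositional using (Unique)
open import Data.List.Membership.Propositional using (_∈_)
open import Relation.Binary.PropositionalEquality using (_≡_; _≢_; refl)
open import Relation.Nullary using (Dec; yes; no)
open import Function.Bundles using (_⇔_)

data Letter : Set where
  a b : Letter

_≟L_ : (x y : Letter) → Dec (x ≡ y)
a ≟L a = yes refl
a ≟L b = no (λ ())
b ≟L a = no (λ ())
b ≟L b = yes refl

Word : Set
Word = List Letter

Binary : Word → Set
Binary w = (a ∈ w) × (b ∈ w)

_^_ : Letter → ℕ → Word
x ^ n = replicate n x

infixr 8 _^_

flipL : Letter → Letter
flipL a = b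
flipL b = a

comp : Word → Word
comp = map flipL

consRun : Letter → List (Letter × ℕ) → List (Letter × ℕ)
consRun x [] = (x , 1) ∷ []
consRun x ((y , n) ∷ r) with x ≟L y
... | yes _ = (y , suc n) ∷ r
... | no  _ = (x , 1) ∷ (y , n) ∷ r

rle : Word → List (Letter × ℕ)
rle [] = []
rle (x ∷ xs) = consRun x (rle xs)

l : Word → ℕ
l w = length (rle w)

IsPalindrome : Word → Set
IsPalindrome p = reverse p ≡ p

Factor : Word → Word → Set
Factor p w = ∃[ u ] ∃[ v ] (u ++ p ++ v ≡ w)

Rich : Word → Set
Rich w = Σ (List Word) λ ps →
           Unique ps
         × (∀ p → (p ∈ ps) ⇔ ((p ≢ []) × IsPalindrome p × Factor p w))
         × length ps ≡ length w

_∈BR_ : Word → Word → Set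
v ∈BR w = ∃[ bs ] (1 ≤ length bs × All (λ B → B ≢ []) bs
                   × concat bs ≡ w × concat (reverse bs) ≡ v)

AllBRRich : Word → Set
AllBRRich w = ∀ v → v ∈BR w → Rich v

-- Statements are up to exchanging the two letters

UpToSwap : (Word → Set) → Word → Set
UpToSwap P w = P w ⊎ P (comp w)

P8 : Word → Set
P8 w = w ≡ a ^ 1 ++ b ^ 1 ++ a ^ 1 ++ b ^ 1 ++ a ^ 1 ++ b ^ 1 ++ a ^ 1 ++ b ^ 1

P7 : Word → Set
P7 w = (w ≡ a ^ 1 ++ b ^ 1 ++ a ^ 1 ++ b ^ 1 ++ a ^ 1 ++ b ^ 2 ++ a ^ 1)
     ⊎ (w ≡ a ^ 1 ++ b ^ 1 ++ a ^ 1 ++ b ^ 2 ++ a ^ 1 ++ b ^ 1 ++ a ^ 1)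
     ⊎ (w ≡ a ^ 1 ++ b ^ 2 ++ a ^ 1 ++ b ^ 1 ++ a ^ 1 ++ b ^ 1 ++ a ^ 1)

T : Word → Set
T u = (u ≡ a ^ 1 ++ b ^ 2 ++ a ^ 1 ++ b ^ 1 ++ a ^ 2 ++ b ^ 1)
    ⊎ (u ≡ a ^ 1 ++ b ^ 1 ++ a ^ 1 ++ b ^ 2 ++ a ^ 2 ++ b ^ 1)
    ⊎ (u ≡ a ^ 1 ++ b ^ 1 ++ a ^ 1 ++ b ^ 1 ++ a ^ 2 ++ b ^ 2)
    ⊎ (u ≡ a ^ 2 ++ b ^ 1 ++ a ^ 1 ++ b ^ 2 ++ a ^ 1 ++ b ^ 1)
    ⊎ (u ≡ a ^ 2 ++ b ^ 1 ++ a ^ 1 ++ b ^ 1 ++ a ^ 1 ++ b ^ 2)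
    ⊎ (u ≡ a ^ 1 ++ b ^ 1 ++ a ^ 2 ++ b ^ 2 ++ a ^ 1 ++ b ^ 1)
    ⊎ (∃[ n₁ ] (3 ≤ n₁ × u ≡ a ^ n₁ ++ b ^ 1 ++ a ^ 1 ++ b ^ 1 ++ a ^ 1 ++ b ^ 1))

P6 : Word → Set
P6 w = ∃[ u ] (T u × (w ≡ u ⊎ w ≡ reverse (comp u)))

P5 : Word → Set
P5 w = (∃[ n₁ ] ∃[ n₃ ] ∃[ n₅ ] (1 ≤ n₁ × 1 ≤ n₃ × 1 ≤ n₅
          × w ≡ a ^ n₁ ++ b ^ 1 ++ a ^ n₃ ++ b ^ 1 ++ a ^ n₅))
     ⊎ (∃[ n₂ ] ∃[ n₄ ] (1 ≤ n₂ × 1 ≤ n₄ × n₂ + n₄ ≡ 4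
          × ((w ≡ a ^ 1 ++ b ^ n₂ ++ a ^ 1 ++ b ^ n₄ ++ a ^ 2)
           ⊎ (w ≡ a ^ 2 ++ b ^ n₂ ++ a ^ 1 ++ b ^ n₄ ++ a ^ 1)
           ⊎ (w ≡ a ^ 1 ++ b ^ n₂ ++ a ^ 2 ++ b ^ n₄ ++ a ^ 1))))

Pair31 : ℕ → ℕ → Set
Pair31 x y = (x ≡ 3 × y ≡ 1) ⊎ (x ≡ 2 × y ≡ 2) ⊎ (x ≡ 1 × y ≡ 3)

S : Word → Set
S w = ∃[ n₁ ] ∃[ n₂ ] ∃[ n₃ ] ∃[ n₄ ] (Pair31 n₂ n₄ × Pair31 n₁ n₃
        × w ≡ a ^ n₁ ++ b ^ n₂ ++ a ^ n₃ ++ b ^ n₄)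

P4 : Word → Set
P4 w = (∃[ n₂ ] ∃[ n₄ ] (1 ≤ n₂ × 1 ≤ n₄ × w ≡ a ^ 1 ++ b ^ n₂ ++ a ^ 1 ++ b ^ n₄))
     ⊎ (∃[ n₁ ] ∃[ n₃ ] (1 ≤ n₁ × 1 ≤ n₃ × w ≡ a ^ n₁ ++ b ^ 1 ++ a ^ n₃ ++ b ^ 1))
     ⊎ S w

P3 : Word → Set
P3 w = (w ≡ a ^ 2 ++ b ^ 4 ++ a ^ 2)
     ⊎ (∃[ n₂ ] (1 ≤ n₂ × w ≡ a ^ 1 ++ b ^ n₂ ++ a ^ 1))
     ⊎ (∃[ n₁ ] ∃[ n₃ ] (1 ≤ n₁ × 1 ≤ n₃ × w ≡ a ^ n₁ ++ b ^ 1 ++ a ^ n₃))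
     ⊎ (∃[ n₁ ] ∃[ n₃ ] (1 ≤ n₁ × 1 ≤ n₃ × w ≡ a ^ n₁ ++ b ^ 2 ++ a ^ n₃))
     ⊎ (∃[ n₂ ] ∃[ n₃ ] ((n₂ ≡ 3 ⊎ n₂ ≡ 4) × 3 ≤ n₃ × w ≡ a ^ 1 ++ b ^ n₂ ++ a ^ n₃))
     ⊎ (∃[ n₁ ] ∃[ n₂ ] ((n₂ ≡ 3 ⊎ n₂ ≡ 4) × 3 ≤ n₁ × w ≡ a ^ n₁ ++ b ^ n₂ ++ a ^ 1))

Case : ℕ → (Word → Set) → Set
Case k P = ∀ w → Binary w → 7 < length w → l w ≡ k → (AllBRRich w ⇔ UpToSwap P w)

{-# OPTIONS --safe #-}
module Submission where

-- A word x w is rich iff w is rich and x w has a palindromic prefix that does not occur in w: prepending a letter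
-- creates at most one new palindrome, since a shorter palindromic prefix is a suffix of a longer one.  Hence richness
-- is decidable and inherited by factors.
--
-- Necessity: if w contains disjoint factors s, m = B₁⋯Bₜ, s′ in this order, then s′ Bₜ⋯B₁ s is a factor of an element
-- of BR(w).  A finite table of triples for which that word is not rich excludes every word outside the lists; the run
-- lengths are split into finitely many cases "= c" or "≥ c".
--
-- Sufficiency: the sporadic words, all of length 8, are checked exhaustively.  In the infinite families one letter,
-- say b, is rare.  Whether a^g₀ b a^g₁ b ⋯ b a^gₙ is rich depends only on the order relations among the gaps gᵢ, so
-- every word with at most two b's is rich, and for a^n followed by a fixed word finitely many gap sequences have to
-- be checked.

open import Defs
open import Data.Empty using (⊥)
open import Data.List using (List; []; _∷_; [_]; _++_; _∷ʳ_; concat; concatMap; filter; length; map; replicate; reverse; take)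
open import Data.List.Membership.Propositional using (_∈_; find)
open import Data.List.Membership.Propositional.Properties using (∈-++⁺ʳ; ∈-++⁺ˡ; ∈-filter⁺; ∈-filter⁻; ∈-map⁺; ∈-map⁻)
open import Data.List.Properties using (++-assoc; ++-conicalʳ; ++-conicalˡ; ++-identityʳ; ++-monoid; concat-++; concat-map; filter-all; length-++; length-map; length-replicate; length-reverse; map-++; map-cong; map-id; map-replicate; map-∘; reverse-++; reverse-involutive; reverse-map; unfold-reverse; ∷-injective; ≡-dec)
open import Data.List.Relation.Binary.Infix.Heterogeneous using (Infix; MkView; toView)
open import Data.List.Relation.Binary.Infix.Heterogeneous.Properties using (Infix-Prefix-trans; infix?)
open import Data.List.Relation.Binary.Pointwise as Pointwise using (Pointwise; []; _∷_)
open import Data.List.Relation.Binary.Prefix.Heterogeneous.Properties using (fromPointwise)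
open import Data.List.Relation.Unary.All as All using (All; []; _∷_; all?)
import Data.List.Relation.Unary.All.Properties as All
open import Data.List.Relation.Unary.AllPairs using ([]; _∷_)
open import Data.List.Relation.Unary.Any as Any using (Any; any?; here; there)
open import Data.List.Relation.Unary.Unique.Propositional using (Unique)
import Data.List.Relation.Unary.Unique.Propositional.Properties as Unique
open import Data.Maybe using (Maybe; just; nothing; _<∣>_; from-just) renaming (map to mapMaybe; zipWith to zipMaybe)
open import Data.Nat using (ℕ; zero; suc; _+_; _∸_; _≟_; _≤?_; _<?_; _≤_; _<_; _⊓_; z≤n; s≤s; s≤s⁻¹)
open import Data.Nat.ListAction using (sum)
open import Data.Nat.Properties using (+-comm; +-identityʳ; 1+n≰n; <-trans; <⇒≤; <⇒≱; m+[n∸m]≡n; mono-≤-distrib-⊓; m∸n+n≡m; m≤m+n; m≤n+m; m≤n⇒m<n∨m≡n; m≤n⇒m≤1+n; m⊓n≤m; ≤-antisym; ≤-refl; ≤-reflexive; ≤-total; ≤-trans; ≮⇒≥; ≰⇒>; ⊓-glb)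
open import Data.Product using (∃; ∃-syntax; _×_; _,_; map₁; proj₂)
open import Data.Sum using (_⊎_; inj₁; inj₂; [_,_]′)
open import Data.Unit using (⊤; tt)
open import Function.Bundles using (_⇔_; Equivalence; mk⇔)
open import Relation.Binary.PropositionalEquality using (_≡_; _≢_; cong; cong₂; module ≡-Reasoning; refl; subst; sym; trans)
open import Relation.Nullary using (Dec; no; yes; ¬_; contradiction)
open import Relation.Nullary.Decidable using (True; _×-dec_; _⊎-dec_; dec⇒maybe; decidable-stable; map′; toWitness; ¬?)
open import Tactic.MonoidSolver using (solve)

-- Palindromic prefixes and factors

-- Why only the order of the gaps matters: a palindromic prefix containing b has the form a^i b a^c₁
-- b ⋯ b a^cₙ b a^i. Its inner runs must equal whole gaps, while its two end runs only have to fit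
-- into gaps. Occurrence is thus expressed by = and ≤ alone, which every strictly increasing map of
-- the gaps preserves and reflects. Why a^n t is a finite problem: blocks inside a^n move to the end
-- and merge there, and the block that leaves a^n takes a prefix p of t with it. Every reversal is
-- therefore x a^k p a^m with t = p s and x a reversal of s. Only k and m are unbounded. The
-- exponent m may be enlarged, because richness passes to prefixes; k = 0, 1, 2 are treated one by
-- one; for k ≥ 3 the gaps of x a^3 p a^6 are stretched. The tails t in question contain at most two
-- a's, so the fixed gaps (at most 2), those near a^k (3 to 5) and those near a^m (6 and more) stay
-- in separate ranges. For necessity, the search returns a certificate that is interpreted
-- afterwards, so the search itself carries no correctness proof.

Prefix : {A : Set} → List A → List A → Set
Prefix p w = ∃[ v ] (p ++ v ≡ w)

prefix? : ∀ (p w : Word) → Dec (Prefix p w)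
prefix? []      w       = yes (w , refl)
prefix? (x ∷ p) []      = no λ ()
prefix? (x ∷ p) (y ∷ w) =
  map′ (λ { (refl , v , refl) → v , refl }) (λ { (v , refl) → refl , v , refl })
       (x ≟L y ×-dec prefix? p w)

factor-uncons : ∀ {p x w} → Factor p (x ∷ w) → Prefix p (x ∷ w) ⊎ Factor p w
factor-uncons ([]    , v , eq)   = inj₁ (v , eq)
factor-uncons (_ ∷ u , v , refl) = inj₂ (u , v , refl)

factor-there : ∀ {p x w} → Factor p w → Factor p (x ∷ w)
factor-there {x = x} (u , v , eq) = x ∷ u , v , cong (x ∷_) eq

factor-[] : ∀ {p} → Factor p [] → p ≡ []
factor-[] {p} (u , v , eq) = ++-conicalˡ p v (++-conicalʳ u (p ++ v) eq)

factor? : ∀ p w → Dec (Factor p w)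
factor? p []      = map′ ([] ,_) (λ { ([] , v , eq) → v , eq }) (prefix? p [])
factor? p (x ∷ w) = map′ [ ([] ,_) , factor-there ]′ factor-uncons (prefix? p (x ∷ w) ⊎-dec factor? p w)

palindrome? : ∀ p → Dec (IsPalindrome p)
palindrome? p = ≡-dec _≟L_ (reverse p) p

prefixes-comparable : ∀ p {u} q {v : Word} → p ++ u ≡ q ++ v →
                      (∃[ t ] q ≡ p ++ t) ⊎ (∃[ t ] p ≡ q ++ t)
prefixes-comparable []      q       _  = inj₁ (q , refl)
prefixes-comparable (x ∷ p) []      _  = inj₂ (x ∷ p , refl)
prefixes-comparable (x ∷ p) (y ∷ q) eq with ∷-injective eq
... | refl , eq′ with prefixes-comparable p q eq′
...   | inj₁ (t , e) = inj₁ (t , cong (x ∷_) e)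
...   | inj₂ (t , e) = inj₂ (t , cong (x ∷_) e)

PalFactor : Word → Word → Set
PalFactor w p = (p ≢ []) × IsPalindrome p × Factor p w

NewPal : Letter → Word → Word → Set
NewPal x w p = (p ≢ []) × IsPalindrome p × Prefix p (x ∷ w) × ¬ Factor p w

palFactor-new : ∀ {x w p} → PalFactor (x ∷ w) p → ¬ Factor p w → NewPal x w p
palFactor-new (ne , pal , f) nf with factor-uncons f
... | inj₁ pre = ne , pal , pre , nf
... | inj₂ f′  = contradiction f′ nf

-- A shorter palindromic prefix is also a suffix of a longer one, hence occurs again.
shorter-not-new : ∀ {x w p} q t → IsPalindrome p → IsPalindrome q → Prefix q (x ∷ w) →
                  q ≡ p ++ t → ¬ Factor p w → p ≡ q
shorter-not-new {x} {w} {p} q t pp pq (v , eq) q≡pt nf with reverse t in rt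
... | [] = sym (trans q≡pt (trans (cong (p ++_) t≡[]) (++-identityʳ p)))
  where
  t≡[] : t ≡ []
  t≡[] = trans (sym (reverse-involutive t)) (cong reverse rt)
... | y ∷ s = contradiction (s , v , proj₂ (∷-injective split)) nf
  where
  open ≡-Reasoning
  q≡ysp : q ≡ y ∷ s ++ p
  q≡ysp = begin
    q                      ≡⟨ pq ⟨
    reverse q              ≡⟨ cong reverse q≡pt ⟩
    reverse (p ++ t)       ≡⟨ reverse-++ p t ⟩
    reverse t ++ reverse p ≡⟨ cong₂ _++_ rt pp ⟩
    y ∷ s ++ p             ∎
  split : y ∷ s ++ p ++ v ≡ x ∷ w
  split = begin
    y ∷ s ++ p ++ v   ≡⟨ ++-assoc (y ∷ s) p v ⟨
    (y ∷ s ++ p) ++ v ≡⟨ cong (_++ v) q≡ysp ⟨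
    q ++ v            ≡⟨ eq ⟩
    x ∷ w             ∎

newPal-unique : ∀ {x w p q} → NewPal x w p → NewPal x w q → p ≡ q
newPal-unique {p = p} {q} (_ , pp , (u , e) , np) (_ , pq , (v , f) , nq)
  with prefixes-comparable p q (trans e (sym f))
... | inj₁ (t , eq) = shorter-not-new q t pp pq (v , f) eq np
... | inj₂ (t , eq) = sym (shorter-not-new p t pq pp (u , e) eq nq)

-- Counting palindromes

-- Two entries that do not occur in `w` would both be `NewPal` and hence equal. After the first such
-- entry the filter therefore keeps everything.
length≤1+old : ∀ {x w} ps → Unique ps → All (PalFactor (x ∷ w)) ps →
               length ps ≤ suc (length (filter (λ p → factor? p w) ps))
length≤1+old []       _        _          = z≤n
length≤1+old {x} {w} (p ∷ ps) (p∉ ∷ uq) (pf ∷ pfs) with factor? p w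
... | yes f = s≤s (length≤1+old ps uq pfs)
... | no nf =
  s≤s (≤-reflexive (cong length (sym (filter-all (λ q → factor? q w) old))))
  where
  old : All (λ q → Factor q w) ps
  old = All.map (λ { (p≢q , qf) → decidable-stable (factor? _ w)
                     λ nfq → p≢q (newPal-unique (palFactor-new pf nf) (palFactor-new qf nfq)) })
                (All.zip (p∉ , pfs))

old-palFactors : ∀ {x w} ps → All (PalFactor (x ∷ w)) ps → All (PalFactor w) (filter (λ p → factor? p w) ps)
old-palFactors {w = w} ps pfs =
  All.map (λ { (f , ne , pal , _) → ne , pal , f })
          (All.zip (All.all-filter (λ p → factor? p w) ps , All.filter⁺ (λ p → factor? p w) pfs))

palFactors-bound : ∀ w ps → Unique ps → All (PalFactor w) ps → length ps ≤ length w
palFactors-bound w       []       _  _                  = z≤n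
palFactors-bound []      (p ∷ ps) _  ((ne , _ , f) ∷ _) = contradiction (factor-[] f) ne
palFactors-bound (x ∷ w) ps@(_ ∷ _) uq pfs = ≤-trans (length≤1+old ps uq pfs)
  (s≤s (palFactors-bound w _ (Unique.filter⁺ (λ p → factor? p w) uq) (old-palFactors ps pfs)))

rich-palFactors : ∀ {w} ((ps , _) : Rich w) → All (PalFactor w) ps
rich-palFactors (ps , _ , spec , _) = All.tabulate (λ {p} → Equivalence.to (spec p))

rich-[] : Rich []
rich-[] = [] , [] , (λ p → mk⇔ (λ ()) (λ { (ne , _ , f) → contradiction (factor-[] f) ne })) , refl

-- Richness is equality in `palFactors-bound`. Removing `x` costs at most one palindrome, so the
-- palindromes left over still attain the bound for `w`.
rich-tail : ∀ {x w} → Rich (x ∷ w) → Rich w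
rich-tail {x} {w} r@(ps , uq , spec , len) = qs , uq′ , spec′ , ≤-antisym upper lower
  where
  f? = λ p → factor? p w
  qs = filter f? ps
  uq′ = Unique.filter⁺ f? uq
  upper = palFactors-bound w qs uq′ (old-palFactors ps (rich-palFactors r))
  lower = s≤s⁻¹ (≤-trans (≤-reflexive (sym len)) (length≤1+old ps uq (rich-palFactors r)))
  spec′ : ∀ p → (p ∈ qs) ⇔ PalFactor w p
  spec′ p = mk⇔
    (λ p∈ → let (p∈ps , f) = ∈-filter⁻ f? p∈
                (ne , pal , _) = Equivalence.to (spec p) p∈ps in ne , pal , f)
    (λ { (ne , pal , f) → ∈-filter⁺ f? (Equivalence.from (spec p) (ne , pal , factor-there f)) f })

-- If every listed palindrome occurred in `w`, there would be one more of them than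
-- `palFactors-bound` allows for `w`.
rich-newPal : ∀ {x w} → Rich (x ∷ w) → ∃ (NewPal x w)
rich-newPal {x} {w} r@(ps , uq , _ , len) with any? (λ p → ¬? (factor? p w)) ps
... | yes new = let (p , p∈ , nf) = find new in p , palFactor-new (All.lookup (rich-palFactors r) p∈) nf
... | no none = contradiction
        (≤-trans (≤-reflexive (sym len)) (palFactors-bound w ps uq old)) 1+n≰n
  where
  old : All (PalFactor w) ps
  old = All.map (λ { (nnf , ne , pal , _) → ne , pal , decidable-stable (factor? _ w) nnf })
                (All.zip (All.¬Any⇒All¬ ps none , rich-palFactors r))

rich-cons : ∀ {x w p} → Rich w → NewPal x w p → Rich (x ∷ w)
rich-cons {x} {w} {p} r@(ps , uq , spec , len) new@(ne , pal , pre , nf) =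
  p ∷ ps , All.map (λ { (_ , _ , f) refl → nf f }) (rich-palFactors r) ∷ uq , spec′ , cong suc len
  where
  spec′ : ∀ q → (q ∈ p ∷ ps) ⇔ PalFactor (x ∷ w) q
  spec′ q = mk⇔ to from
    where
    to : q ∈ p ∷ ps → PalFactor (x ∷ w) q
    to (here refl) = ne , pal , [] , pre
    to (there q∈)  = let (ne′ , pal′ , f) = Equivalence.to (spec q) q∈ in ne′ , pal′ , factor-there f
    from : PalFactor (x ∷ w) q → q ∈ p ∷ ps
    from qf@(ne′ , pal′ , _) with factor? q w
    ... | yes f  = there (Equivalence.from (spec q) (ne′ , pal′ , f))
    ... | no nfq = here (newPal-unique (palFactor-new qf nfq) new)

anyPrefix? : ∀ {A : Set} {P : List A → Set} → (∀ p → Dec (P p)) → ∀ w → Dec (∃[ p ] (Prefix p w × P p))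
anyPrefix? P? []      = map′ (λ Pp → [] , ([] , refl) , Pp) (λ { ([] , _ , Pp) → Pp }) (P? [])
anyPrefix? {P = P} P? (x ∷ w) = map′ to from (P? [] ⊎-dec anyPrefix? (λ p → P? (x ∷ p)) w)
  where
  to : P [] ⊎ ∃[ p ] (Prefix p w × P (x ∷ p)) → ∃[ p ] (Prefix p (x ∷ w) × P p)
  to (inj₁ Pp)                    = [] , (x ∷ w , refl) , Pp
  to (inj₂ (p , (v , refl) , Pp)) = x ∷ p , (v , refl) , Pp
  from : ∃[ p ] (Prefix p (x ∷ w) × P p) → P [] ⊎ ∃[ p ] (Prefix p w × P (x ∷ p))
  from ([] , _ , Pp)               = inj₁ Pp
  from (y ∷ p , (v , refl) , Pp)   = inj₂ (p , (v , refl) , Pp)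

newPal? : ∀ x w → Dec (∃ (NewPal x w))
newPal? x w = map′
  (λ { (p , (v , refl) , pal , nf) → x ∷ p , (λ ()) , pal , (v , refl) , nf })
  (λ { ([] , ne , _) → contradiction refl ne
     ; (y ∷ p , _ , pal , (v , refl) , nf) → p , (v , refl) , pal , nf })
  (anyPrefix? (λ p → palindrome? (x ∷ p) ×-dec ¬? (factor? (x ∷ p) w)) w)

rich? : ∀ w → Dec (Rich w)
rich? []      = yes rich-[]
rich? (x ∷ w) = map′ (λ { (r , _ , new) → rich-cons r new }) (λ r → rich-tail r , rich-newPal r)
                     (rich? w ×-dec newPal? x w)

-- Symmetries and heredity of richness

palindrome-factor-reverse : ∀ {p w} → IsPalindrome p → Factor p w → Factor p (reverse w)
palindrome-factor-reverse {p} pal (u , v , refl) = reverse v , reverse u , sym (begin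
  reverse (u ++ p ++ v)                   ≡⟨ reverse-++ u (p ++ v) ⟩
  reverse (p ++ v) ++ reverse u           ≡⟨ cong (_++ reverse u) (reverse-++ p v) ⟩
  (reverse v ++ reverse p) ++ reverse u   ≡⟨ ++-assoc (reverse v) (reverse p) _ ⟩
  reverse v ++ reverse p ++ reverse u     ≡⟨ cong (λ q → reverse v ++ q ++ reverse u) pal ⟩
  reverse v ++ p ++ reverse u             ∎)
  where open ≡-Reasoning

rich-reverse : ∀ {w} → Rich w → Rich (reverse w)
rich-reverse {w} (ps , uq , spec , len) = ps , uq , spec′ , trans len (sym (length-reverse w))
  where
  spec′ : ∀ p → (p ∈ ps) ⇔ PalFactor (reverse w) p
  spec′ p = mk⇔
    (λ p∈ → let (ne , pal , f) = Equivalence.to (spec p) p∈ in ne , pal , palindrome-factor-reverse pal f)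
    (λ { (ne , pal , f) → Equivalence.from (spec p)
       (ne , pal , subst (Factor p) (reverse-involutive w) (palindrome-factor-reverse pal f)) })

rich-suffix : ∀ u {w} → Rich (u ++ w) → Rich w
rich-suffix []      r = r
rich-suffix (_ ∷ u) r = rich-suffix u (rich-tail r)

rich-prefix : ∀ w {v} → Rich (w ++ v) → Rich w
rich-prefix w {v} r = subst Rich (reverse-involutive w)
  (rich-reverse (rich-suffix (reverse v) (subst Rich (reverse-++ w v) (rich-reverse r))))

flipL-involutive : ∀ x → flipL (flipL x) ≡ x
flipL-involutive a = refl
flipL-involutive b = refl

comp-involutive : ∀ w → comp (comp w) ≡ w
comp-involutive w = trans (sym (map-∘ w)) (trans (map-cong flipL-involutive w) (map-id w))

comp-palFactor : ∀ {w p} → PalFactor w p → PalFactor (comp w) (comp p)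
comp-palFactor {w} {[]}    (ne , _ , _)  = contradiction refl ne
comp-palFactor {w} {x ∷ p} (_ , pal , u , v , refl) =
  (λ ()) , trans (sym (reverse-map flipL (x ∷ p))) (cong comp pal) , comp u , comp v ,
  sym (trans (map-++ flipL u _) (cong (comp u ++_) (map-++ flipL (x ∷ p) v)))

rich-comp : ∀ {w} → Rich w → Rich (comp w)
rich-comp {w} (ps , uq , spec , len) =
  map comp ps , Unique.map⁺ comp-injective uq , spec′ , trans (length-map comp ps) (trans len (sym (length-map flipL w)))
  where
  comp-injective : ∀ {p q} → comp p ≡ comp q → p ≡ q
  comp-injective {p} {q} eq = trans (sym (comp-involutive p)) (trans (cong comp eq) (comp-involutive q))
  spec′ : ∀ p → (p ∈ map comp ps) ⇔ PalFactor (comp w) p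
  spec′ p = mk⇔
    (λ p∈ → let (q , q∈ , p≡) = ∈-map⁻ comp p∈ in
            subst (PalFactor (comp w)) (sym p≡) (comp-palFactor (Equivalence.to (spec q) q∈)))
    (λ pf → subst (_∈ map comp ps) (comp-involutive p)
      (∈-map⁺ comp (Equivalence.from (spec (comp p))
        (subst (λ u → PalFactor u (comp p)) (comp-involutive w) (comp-palFactor pf)))))

-- Block reversals

concat-reverse-∷ : ∀ (B : Word) bs → concat (reverse (B ∷ bs)) ≡ concat (reverse bs) ++ B
concat-reverse-∷ B bs = begin
  concat (reverse (B ∷ bs))          ≡⟨ cong concat (unfold-reverse B bs) ⟩
  concat (reverse bs ∷ʳ B)           ≡⟨ concat-++ (reverse bs) (B ∷ []) ⟨
  concat (reverse bs) ++ B ++ []     ≡⟨ cong (concat (reverse bs) ++_) (++-identityʳ B) ⟩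
  concat (reverse bs) ++ B           ∎
  where open ≡-Reasoning

-- Allows empty blocks in the witnesses for `_∈BR_`, so that later factorisations need no case
-- distinction on which pieces are empty.
nonEmptyBlocks : ∀ bs → ∃[ cs ] (All (_≢ []) cs × concat cs ≡ concat bs
                                 × concat (reverse cs) ≡ concat (reverse bs))
nonEmptyBlocks [] = [] , [] , refl , refl
nonEmptyBlocks (B ∷ bs) with nonEmptyBlocks bs
nonEmptyBlocks ([] ∷ bs)      | cs , ne , e , f =
  cs , ne , e , trans f (sym (trans (concat-reverse-∷ [] bs) (++-identityʳ _)))
nonEmptyBlocks (B@(_ ∷ _) ∷ bs) | cs , ne , e , f =
  B ∷ cs , (λ ()) ∷ ne , cong (B ++_) e ,
  trans (concat-reverse-∷ B cs) (trans (cong (_++ B) f) (sym (concat-reverse-∷ B bs)))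

∈BR-concat : ∀ bs → concat bs ≢ [] → concat (reverse bs) ∈BR concat bs
∈BR-concat bs w≢[] with nonEmptyBlocks bs
... | []         , _  , e , _ = contradiction (sym e) w≢[]
... | cs@(_ ∷ _) , ne , e , f = cs , s≤s z≤n , ne , e , f

data Reversal : Word → Word → Set where
  []   : Reversal [] []
  step : ∀ x B {s v} → Reversal s v → Reversal (x ∷ B ++ s) (v ++ x ∷ B)

concat-reversal : ∀ {bs} → All (_≢ []) bs → Reversal (concat bs) (concat (reverse bs))
concat-reversal [] = []
concat-reversal {[] ∷ bs}      (ne ∷ _)  = contradiction refl ne
concat-reversal {(x ∷ B) ∷ bs} (_ ∷ nes) =
  subst (Reversal _) (sym (concat-reverse-∷ (x ∷ B) bs)) (step x B (concat-reversal nes))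

∈BR⇒reversal : ∀ {v w} → v ∈BR w → Reversal w v
∈BR⇒reversal (bs , _ , ne , refl , refl) = concat-reversal ne

-- `B` is the block currently open: the next letter either extends it, or closes it and sends it to
-- the far end.
reversals-block : Word → Word → List Word
reversals-block B []      = B ∷ []
reversals-block B (x ∷ s) = reversals-block (B ∷ʳ x) s ++ map (_++ B) (reversals-block [ x ] s)

reversals : Word → List Word
reversals []      = [] ∷ []
reversals (x ∷ s) = reversals-block [ x ] s

-- The open block is `B ++ u`, with `B` already read and `u` still to come. Once `u` is used up, the
-- block is closed and the next one opens with its first letter.
reversal∈block : ∀ {s v} → Reversal s v → ∀ B u → v ++ B ++ u ∈ reversals-block B (u ++ s)
reversal∈block [] B []         = here (++-identityʳ B)
reversal∈block (step x C r) B [] =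
  ∈-++⁺ʳ (reversals-block (B ∷ʳ x) (C ++ _))
    (subst (_∈ _) (cong ((_ ++ x ∷ C) ++_) (sym (++-identityʳ B)))
      (∈-map⁺ (_++ B) (reversal∈block r [ x ] C)))
reversal∈block {s} {v} r B (y ∷ u) =
  ∈-++⁺ˡ (subst (_∈ _) (cong (v ++_) (++-assoc B [ y ] u)) (reversal∈block r (B ∷ʳ y) u))

reversal∈reversals : ∀ {s v} → Reversal s v → v ∈ reversals s
reversal∈reversals []           = here refl
reversal∈reversals (step x B r) = reversal∈block r [ x ] B

AllReversalsRich : Word → Set
AllReversalsRich w = All Rich (reversals w)

allReversalsRich? : ∀ w → Dec (AllReversalsRich w)
allReversalsRich? w = all? rich? (reversals w)

allReversalsRich⇒allBRRich : ∀ {w} → AllReversalsRich w → AllBRRich w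
allReversalsRich⇒allBRRich rs v v∈ = All.lookup rs (reversal∈reversals (∈BR⇒reversal v∈))

allBRRich-comp : ∀ {w} → AllBRRich w → AllBRRich (comp w)
allBRRich-comp {w} h v (bs , 1≤ , ne , e , f) =
  subst Rich (comp-involutive v) (rich-comp (h (comp v) (∈w bs 1≤ ne e f)))
  where
  comp≢[] : ∀ {B} → B ≢ [] → comp B ≢ []
  comp≢[] {[]}    ne _ = ne refl
  comp≢[] {_ ∷ _} _ ()
  ∈w : ∀ bs → 1 ≤ length bs → All (_≢ []) bs → concat bs ≡ comp w → concat (reverse bs) ≡ v → comp v ∈BR w
  ∈w bs@(_ ∷ _) 1≤ ne e f =
    map comp bs , s≤s z≤n , All.map⁺ (All.map comp≢[] ne) ,
    trans (concat-map bs) (trans (cong comp e) (comp-involutive w)) ,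
    trans (cong concat (sym (reverse-map comp bs))) (trans (concat-map (reverse bs)) (cong comp f))

reverse-concat : ∀ (bs : List Word) → reverse (concat bs) ≡ concat (map reverse (reverse bs))
reverse-concat [] = refl
reverse-concat (B ∷ bs) = begin
  reverse (B ++ concat bs)                      ≡⟨ reverse-++ B (concat bs) ⟩
  reverse (concat bs) ++ reverse B              ≡⟨ cong (_++ reverse B) (reverse-concat bs) ⟩
  concat (map reverse (reverse bs)) ++ reverse B ≡⟨ cong (λ bs′ → concat bs′ ++ reverse B) (reverse-map reverse bs) ⟩
  concat (reverse (map reverse bs)) ++ reverse B ≡⟨ concat-reverse-∷ (reverse B) (map reverse bs) ⟨
  concat (reverse (map reverse (B ∷ bs)))       ≡⟨ cong concat (reverse-map reverse (B ∷ bs)) ⟨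
  concat (map reverse (reverse (B ∷ bs)))       ∎
  where open ≡-Reasoning

-- Reversing each block turns a factorisation B₁⋯Bₜ of the reversed word into the factorisation
-- Bₜᴿ⋯B₁ᴿ of `w`, whose block reversal B₁ᴿ⋯Bₜᴿ is the reversal of `v`.
allBRRich-reverse : ∀ {w} → AllBRRich w → AllBRRich (reverse w)
allBRRich-reverse {w} h v (bs , 1≤ , ne , e , f) =
  subst Rich (reverse-involutive v) (rich-reverse (h (reverse v) ∈w))
  where
  cs = map reverse (reverse bs)
  cs≡w : concat cs ≡ w
  cs≡w = trans (sym (reverse-concat bs)) (trans (cong reverse e) (reverse-involutive w))
  rev-cs : concat (reverse cs) ≡ reverse v
  rev-cs = trans (cong concat (sym (reverse-map reverse (reverse bs))))
                 (trans (sym (reverse-concat (reverse bs))) (cong reverse f))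
  w≢[] : concat cs ≢ []
  w≢[] c≡[] = nonempty bs 1≤ ne (trans (sym (reverse-involutive (concat bs)))
                                       (cong reverse (trans (reverse-concat bs) c≡[])))
    where
    nonempty : ∀ bs → 1 ≤ length bs → All (_≢ []) bs → concat bs ≢ []
    nonempty ([] ∷ _) _ (ne ∷ _) _ = ne refl
  ∈w : reverse v ∈BR w
  ∈w = subst (reverse v ∈BR_) cs≡w (subst (_∈BR concat cs) rev-cs (∈BR-concat cs w≢[]))

-- Reversing the blocks around s and s′ brings s′, the blocks Bs in reverse order, and s together.
allBRRich-gapped : ∀ d₀ s d₁ Bs d₂ s′ d₃ {w} → w ≢ [] →
  w ≡ d₀ ++ s ++ d₁ ++ concat Bs ++ d₂ ++ s′ ++ d₃ →
  AllBRRich w → Rich (s′ ++ concat (reverse Bs) ++ s)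
allBRRich-gapped d₀ s d₁ Bs d₂ s′ d₃ {w} w≢[] w≡ h =
  rich-prefix (s′ ++ concat (reverse Bs) ++ s) (rich-suffix (d₃ ++ d₂) (subst Rich eq′ (h _ ∈w)))
  where
  open ≡-Reasoning
  tl = (d₂ ++ s′) ∷ d₃ ∷ []
  -- `d₁` is glued to the right of `s` and `d₂` to the left of `s′`, so after reversing the blocks
  -- both gaps lie outside the part from `s′` to `s`.
  bs = d₀ ∷ (s ++ d₁) ∷ Bs ++ tl
  bs≡w : concat bs ≡ w
  bs≡w = begin
    d₀ ++ (s ++ d₁) ++ concat (Bs ++ (d₂ ++ s′) ∷ d₃ ∷ [])
      ≡⟨ cong (λ t → d₀ ++ (s ++ d₁) ++ t) (concat-++ Bs tl) ⟨
    d₀ ++ (s ++ d₁) ++ concat Bs ++ (d₂ ++ s′) ++ d₃ ++ []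
      ≡⟨ solve (++-monoid Letter) ⟩
    d₀ ++ s ++ d₁ ++ concat Bs ++ d₂ ++ s′ ++ d₃
      ≡⟨ w≡ ⟨
    w ∎
  ∈w : concat (reverse bs) ∈BR w
  ∈w = subst (concat (reverse bs) ∈BR_) bs≡w (∈BR-concat bs (λ e → w≢[] (trans (sym bs≡w) e)))
  r = concat (reverse Bs)
  eq′ : concat (reverse bs) ≡ (d₃ ++ d₂) ++ (s′ ++ r ++ s) ++ d₁ ++ d₀
  eq′ = begin
    concat (reverse bs)
      ≡⟨ trans (concat-reverse-∷ d₀ ((s ++ d₁) ∷ Bs ++ tl)) (cong (_++ d₀) (concat-reverse-∷ (s ++ d₁) (Bs ++ tl))) ⟩
    (concat (reverse (Bs ++ tl)) ++ s ++ d₁) ++ d₀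
      ≡⟨ cong (λ t → (concat t ++ s ++ d₁) ++ d₀) (reverse-++ Bs tl) ⟩
    ((d₃ ++ (d₂ ++ s′) ++ r) ++ s ++ d₁) ++ d₀
      ≡⟨ solve (++-monoid Letter) ⟩
    (d₃ ++ d₂) ++ (s′ ++ r ++ s) ++ d₁ ++ d₀ ∎

-- Run-length patterns

Runs : Set
Runs = List (Letter × ℕ)

unrle : Runs → Word
unrle []            = []
unrle ((x , n) ∷ r) = x ^ n ++ unrle r

unrle-++ : ∀ q r → unrle (q ++ r) ≡ unrle q ++ unrle r
unrle-++ []            r = refl
unrle-++ ((x , n) ∷ q) r = trans (cong (x ^ n ++_) (unrle-++ q r)) (sym (++-assoc (x ^ n) (unrle q) (unrle r)))

unrle-consRun : ∀ x r → unrle (consRun x r) ≡ x ∷ unrle r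
unrle-consRun x []            = refl
unrle-consRun x ((y , n) ∷ r) with x ≟L y
... | yes refl = refl
... | no _     = refl

unrle-rle : ∀ w → unrle (rle w) ≡ w
unrle-rle []      = refl
unrle-rle (x ∷ w) = trans (unrle-consRun x (rle w)) (cong (x ∷_) (unrle-rle w))

data Bound : Set where
  exactly atLeast : ℕ → Bound

Within : Bound → ℕ → Set
Within (exactly c) n = n ≡ c
Within (atLeast c) n = c ≤ n

Pattern : Set
Pattern = List (Letter × Bound)

FitsRun : Letter × Bound → Letter × ℕ → Set
FitsRun (x , c) (y , n) = x ≡ y × Within c n

Fits : Pattern → Runs → Set
Fits = Pointwise FitsRun

alternating : Letter → List Bound → Pattern
alternating x []       = []
alternating x (c ∷ cs) = (x , c) ∷ alternating (flipL x) cs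

rle-fits : ∀ x w → Fits (alternating x (replicate (l (x ∷ w)) (atLeast 1))) (rle (x ∷ w))
rle-fits x []      = (refl , ≤-refl) ∷ []
rle-fits x (y ∷ w) with rle (y ∷ w) | rle-fits y w
... | []           | []                  = (refl , ≤-refl) ∷ []
... | (.y , n) ∷ r | (refl , 1≤n) ∷ fits with x ≟L y
...   | yes refl = (refl , s≤s z≤n) ∷ fits
...   | no x≢y   = (refl , ≤-refl) ∷ (other x y x≢y , 1≤n)
               ∷ subst (λ z → Fits (alternating (flipL z) _) r) (sym (other x y x≢y)) fits
  where
  other : ∀ x y → x ≢ y → flipL x ≡ y
  other a a ne = contradiction refl ne
  other a b ne = refl
  other b a ne = refl
  other b b ne = contradiction refl ne

-- Inclusion between run conditions in decidable, syntactic form, so that the search can compare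
-- patterns without reference to run sequences.
data _⊒_ : Letter × Bound → Letter × Bound → Set where
  exact : ∀ {x c} → (x , exactly c) ⊒ (x , exactly c)
  above : ∀ {x c d} → c ≤ d → (x , atLeast c) ⊒ (x , exactly d)
  raise : ∀ {x c d} → c ≤ d → (x , atLeast c) ⊒ (x , atLeast d)

_⊒?_ : ∀ p q → Dec (p ⊒ q)
(x , exactly c) ⊒? (y , exactly d) =
  map′ (λ { (refl , refl) → exact }) (λ { exact → refl , refl }) (x ≟L y ×-dec c ≟ d)
(x , atLeast c) ⊒? (y , exactly d) =
  map′ (λ { (refl , le) → above le }) (λ { (above le) → refl , le }) (x ≟L y ×-dec c ≤? d)
(x , exactly c) ⊒? (y , atLeast d) = no λ ()
(x , atLeast c) ⊒? (y , atLeast d) =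
  map′ (λ { (refl , le) → raise le }) (λ { (raise le) → refl , le }) (x ≟L y ×-dec c ≤? d)

⊒-fits : ∀ {p q r} → p ⊒ q → FitsRun q r → FitsRun p r
⊒-fits exact      fit           = fit
⊒-fits (above le) (refl , refl) = refl , le
⊒-fits (raise le) (refl , le′)  = refl , ≤-trans le le′

-- Gapped factors that force a non-rich block reversal

-- Expressions made of letters and arbitrary powers. They mediate between a gapped factor, which has
-- explicit gaps, and a run-length pattern, in which neighbouring atoms with the same letter merge
-- into one run.
data Atom : Set where
  lit star : Letter → Atom

data Match : List Atom → Word → Set where
  []   : Match [] []
  lit  : ∀ {x E w} → Match E w → Match (lit x ∷ E) (x ∷ w)
  star : ∀ {x E w} n → Match E w → Match (star x ∷ E) (x ^ n ++ w)

match-++ : ∀ E {F w} → Match (E ++ F) w → ∃[ u ] ∃[ v ] (w ≡ u ++ v × Match E u × Match F v)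
match-++ []           m          = [] , _ , refl , [] , m
match-++ (lit x ∷ E)  (lit m)    with match-++ E m
... | u , v , refl , mu , mv = x ∷ u , v , refl , lit mu , mv
match-++ (star x ∷ E) (star n m) with match-++ E m
... | u , v , refl , mu , mv = x ^ n ++ u , v , sym (++-assoc (x ^ n) u v) , star n mu , mv

match-lits : ∀ s {F w} → Match (map lit s ++ F) w → ∃[ v ] (w ≡ s ++ v × Match F v)
match-lits []      m       = _ , refl , m
match-lits (x ∷ s) (lit m) with match-lits s m
... | v , refl , mv = v , refl , mv

addLit : Letter → Pattern → Pattern
addLit x [] = (x , exactly 1) ∷ []
addLit x ((y , c) ∷ p) with x ≟L y | c
... | yes _ | exactly n = (y , exactly (suc n)) ∷ p
... | yes _ | atLeast n = (y , atLeast (suc n)) ∷ p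
... | no _  | _         = (x , exactly 1) ∷ (y , c) ∷ p

addStar : Letter → Pattern → Pattern
addStar x [] = (x , atLeast 0) ∷ []
addStar x ((y , c) ∷ p) with x ≟L y | c
... | yes _ | exactly n = (y , atLeast n) ∷ p
... | yes _ | atLeast n = (y , atLeast n) ∷ p
... | no _  | _         = (x , atLeast 0) ∷ (y , c) ∷ p

atomRuns : List Atom → Pattern
atomRuns []           = []
atomRuns (lit x ∷ E)  = addLit x (atomRuns E)
atomRuns (star x ∷ E) = addStar x (atomRuns E)

addLit-fits : ∀ x p {r} → Fits (addLit x p) r → ∃[ r′ ] (unrle r ≡ x ∷ unrle r′ × Fits p r′)
addLit-fits x [] ((refl , refl) ∷ []) = [] , refl , []
addLit-fits x ((y , c) ∷ p) fits with x ≟L y | c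
addLit-fits x _ ((refl , refl) ∷ fits) | yes refl | exactly n = (x , n) ∷ _ , refl , (refl , refl) ∷ fits
addLit-fits x _ ((refl , s≤s le) ∷ fits) | yes refl | atLeast n = (x , _) ∷ _ , refl , (refl , le) ∷ fits
addLit-fits x _ ((refl , refl) ∷ fits) | no _ | _ = _ , refl , fits

power-+ : ∀ (x : Letter) m n → x ^ (m + n) ≡ x ^ m ++ x ^ n
power-+ x zero    n = refl
power-+ x (suc m) n = cong (x ∷_) (power-+ x m n)

addStar-fits : ∀ x p {r} → Fits (addStar x p) r → ∃[ n ] ∃[ r′ ] (unrle r ≡ x ^ n ++ unrle r′ × Fits p r′)
addStar-fits x [] ((refl , _) ∷ []) = _ , [] , refl , []
addStar-fits x ((y , c) ∷ p) fits with x ≟L y | c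
addStar-fits x _ {(x , n) ∷ r} ((refl , le) ∷ fits) | yes refl | exactly c =
  n ∸ c , (x , c) ∷ r , eq , (refl , refl) ∷ fits
  where
  eq : x ^ n ++ unrle r ≡ x ^ (n ∸ c) ++ x ^ c ++ unrle r
  eq = trans (cong (λ m → x ^ m ++ unrle r) (sym (m∸n+n≡m le)))
             (trans (cong (_++ unrle r) (power-+ x (n ∸ c) c)) (++-assoc (x ^ (n ∸ c)) (x ^ c) _))
-- The run is already bounded only from below, so the star may take the empty power.
addStar-fits x _ ((refl , le) ∷ fits) | yes refl | atLeast _ = 0 , _ , refl , (refl , le) ∷ fits
addStar-fits x _ ((refl , _) ∷ fits)  | no _     | _         = _ , _ , refl , fits

atomRuns-match : ∀ E {r} → Fits (atomRuns E) r → Match E (unrle r)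
atomRuns-match []           []   = []
atomRuns-match (lit x ∷ E)  fits with addLit-fits x (atomRuns E) fits
... | r′ , eq , fits′ = subst (Match _) (sym eq) (lit (atomRuns-match E fits′))
atomRuns-match (star x ∷ E) fits with addStar-fits x (atomRuns E) fits
... | n , r′ , eq , fits′ = subst (Match _) (sym eq) (star n (atomRuns-match E fits′))

-- cut s Bs s′ stands for the words that contain s, the concatenation of Bs, and s′, in this order and disjointly.
data Cut : Set where
  cut : (s : Word) (Bs : List Word) (s′ : Word) → Cut

headStar : Word → List Atom
headStar []      = []
headStar (x ∷ _) = star x ∷ []

lastStar : Word → List Atom
lastStar w = headStar (reverse w)

-- A star next to a break lets the run at that break be arbitrarily long.
cutAtoms : Cut → List Atom
cutAtoms (cut s Bs s′) =
  headStar s ++ map lit s ++ (lastStar s ++ headStar m) ++ map lit m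
    ++ (lastStar m ++ headStar s′) ++ map lit s′ ++ lastStar s′
  where m = concat Bs

cutPattern : Cut → Pattern
cutPattern e = atomRuns (cutAtoms e)

cutWord : Cut → Word
cutWord (cut s Bs s′) = s′ ++ concat (reverse Bs) ++ s

allBRRich-cut : ∀ e {r} → Infix FitsRun (cutPattern e) r → unrle r ≢ [] →
                AllBRRich (unrle r) → Rich (cutWord e)
allBRRich-cut e@(cut s Bs s′) inf w≢[] h
  with MkView pre {q} fits post ← toView inf
  with d₀ , _ , e₀ , _ , m₀ ← match-++ (headStar s) (atomRuns-match (cutAtoms e) fits)
  with _ , refl , m₁ ← match-lits s m₀
  with d₁ , _ , refl , _ , m₂ ← match-++ (lastStar s ++ headStar (concat Bs)) m₁
  with _ , refl , m₃ ← match-lits (concat Bs) m₂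
  with d₂ , _ , refl , _ , m₄ ← match-++ (lastStar (concat Bs) ++ headStar s′) m₃
  with d₃ , refl , _ ← match-lits s′ m₄
  -- The stars supply the gaps `d₀` to `d₃`; the runs outside the matched ones are absorbed into the
  -- outer two.
  = allBRRich-gapped (unrle pre ++ d₀) s d₁ Bs d₂ s′ (d₃ ++ unrle post) w≢[] eq h
  where
  open ≡-Reasoning
  m = concat Bs
  eq : unrle (pre ++ q ++ post) ≡ (unrle pre ++ d₀) ++ s ++ d₁ ++ m ++ d₂ ++ s′ ++ d₃ ++ unrle post
  eq = begin
    unrle (pre ++ q ++ post)           ≡⟨ unrle-++ pre (q ++ post) ⟩
    unrle pre ++ unrle (q ++ post)     ≡⟨ cong (unrle pre ++_) (unrle-++ q post) ⟩
    unrle pre ++ unrle q ++ unrle post ≡⟨ cong (λ u → unrle pre ++ u ++ unrle post) e₀ ⟩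
    unrle pre ++ (d₀ ++ s ++ d₁ ++ m ++ d₂ ++ s′ ++ d₃) ++ unrle post
      ≡⟨ regroup (unrle pre) (unrle post) m ⟩
    (unrle pre ++ d₀) ++ s ++ d₁ ++ m ++ d₂ ++ s′ ++ d₃ ++ unrle post ∎
    where
    regroup : ∀ u v m → u ++ (d₀ ++ s ++ d₁ ++ m ++ d₂ ++ s′ ++ d₃) ++ v
                      ≡ (u ++ d₀) ++ s ++ d₁ ++ m ++ d₂ ++ s′ ++ d₃ ++ v
    regroup u v m = solve (++-monoid Letter)

compCut reverseCut : Cut → Cut
compCut (cut s Bs s′)    = cut (comp s) (map comp Bs) (comp s′)
reverseCut (cut s Bs s′) = cut (reverse s′) (map reverse (reverse Bs)) (reverse s)

-- Found by computer search, one per class under reversal and complement.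
basicCuts : List Cut
basicCuts =
  cut (a ∷ b ∷ b ∷ []) ((a ∷ b ∷ []) ∷ []) (b ∷ b ∷ a ∷ [])
  ∷ cut (a ∷ a ∷ b ∷ b ∷ []) ((b ∷ []) ∷ []) (b ∷ b ∷ a ∷ [])
  ∷ cut (a ∷ b ∷ a ∷ b ∷ b ∷ []) [] (b ∷ b ∷ a ∷ [])
  ∷ cut (a ∷ a ∷ []) ((b ∷ []) ∷ (a ∷ []) ∷ (a ∷ b ∷ b ∷ []) ∷ []) (a ∷ [])
  ∷ cut (a ∷ a ∷ []) ((b ∷ []) ∷ (a ∷ b ∷ a ∷ b ∷ []) ∷ []) (a ∷ [])
  ∷ cut (a ∷ []) ((b ∷ a ∷ []) ∷ (a ∷ b ∷ a ∷ b ∷ []) ∷ []) (a ∷ [])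
  ∷ cut (a ∷ []) ((b ∷ b ∷ a ∷ []) ∷ (a ∷ []) ∷ []) (a ∷ a ∷ b ∷ [])
  ∷ cut (a ∷ a ∷ []) ((b ∷ a ∷ b ∷ b ∷ []) ∷ []) (a ∷ a ∷ [])
  ∷ cut (a ∷ []) ((b ∷ a ∷ []) ∷ (a ∷ []) ∷ (a ∷ b ∷ b ∷ []) ∷ []) (a ∷ [])
  ∷ cut (a ∷ a ∷ []) ((a ∷ b ∷ []) ∷ (b ∷ b ∷ []) ∷ []) (a ∷ a ∷ [])
  ∷ cut (a ∷ a ∷ []) ((a ∷ b ∷ a ∷ b ∷ b ∷ []) ∷ []) (a ∷ [])
  ∷ cut (a ∷ a ∷ []) ((a ∷ b ∷ b ∷ a ∷ b ∷ []) ∷ []) (a ∷ [])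
  ∷ cut (a ∷ a ∷ []) ((b ∷ b ∷ []) ∷ []) (a ∷ a ∷ b ∷ a ∷ [])
  ∷ cut (a ∷ a ∷ []) [] (a ∷ a ∷ b ∷ a ∷ b ∷ b ∷ [])
  ∷ cut (a ∷ a ∷ []) [] (a ∷ a ∷ b ∷ b ∷ a ∷ b ∷ [])
  ∷ cut (a ∷ a ∷ []) ((a ∷ b ∷ []) ∷ []) (a ∷ a ∷ b ∷ b ∷ [])
  ∷ cut (a ∷ a ∷ []) ((a ∷ b ∷ b ∷ []) ∷ []) (a ∷ a ∷ b ∷ [])
  ∷ cut (a ∷ []) ((a ∷ b ∷ a ∷ []) ∷ []) (a ∷ a ∷ b ∷ b ∷ [])
  ∷ cut (a ∷ []) ((a ∷ b ∷ b ∷ a ∷ []) ∷ []) (a ∷ a ∷ b ∷ [])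
  ∷ cut (a ∷ a ∷ b ∷ b ∷ []) [] (b ∷ b ∷ a ∷ b ∷ [])
  ∷ cut (a ∷ a ∷ []) [] (a ∷ a ∷ b ∷ b ∷ b ∷ a ∷ b ∷ [])
  ∷ cut (a ∷ []) [] (a ∷ a ∷ b ∷ b ∷ b ∷ a ∷ b ∷ a ∷ [])
  ∷ cut (a ∷ a ∷ []) ((b ∷ []) ∷ []) (a ∷ a ∷ b ∷ a ∷ b ∷ [])
  ∷ cut (a ∷ []) ((a ∷ []) ∷ (b ∷ a ∷ b ∷ []) ∷ []) (a ∷ a ∷ b ∷ [])
  ∷ cut [] ((a ∷ []) ∷ (b ∷ a ∷ []) ∷ []) (a ∷ a ∷ b ∷ a ∷ b ∷ [])
  ∷ cut [] ((a ∷ b ∷ a ∷ a ∷ []) ∷ (b ∷ []) ∷ []) (a ∷ a ∷ b ∷ [])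
  ∷ cut [] ((a ∷ []) ∷ (b ∷ a ∷ b ∷ a ∷ []) ∷ []) (a ∷ a ∷ b ∷ [])
  ∷ cut (a ∷ []) ((a ∷ a ∷ b ∷ []) ∷ []) (a ∷ b ∷ a ∷ b ∷ b ∷ [])
  ∷ cut (a ∷ b ∷ a ∷ a ∷ []) ((b ∷ []) ∷ (a ∷ b ∷ []) ∷ []) (a ∷ [])
  ∷ cut (a ∷ []) ((a ∷ b ∷ []) ∷ (a ∷ b ∷ b ∷ []) ∷ []) (a ∷ b ∷ a ∷ [])
  ∷ []

-- The symmetric copies are listed outright and each is tested by evaluation in `cuts-notRich`, so
-- no symmetry argument enters here.
cuts : List Cut
cuts = reversed ++ map compCut reversed
  where reversed = basicCuts ++ map reverseCut basicCuts

cuts-notRich : All (λ e → ¬ Rich (cutWord e)) cuts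
cuts-notRich = toWitness {a? = all? (λ e → ¬? (rich? (cutWord e))) cuts} _

IsExact : Letter × Bound → Set
IsExact (_ , c) = ∃[ n ] c ≡ exactly n

isExact? : ∀ p → Dec (IsExact p)
isExact? (_ , exactly n) = yes (n , refl)
isExact? (_ , atLeast _) = no λ ()

low : Letter × Bound → ℕ
low (_ , exactly n) = n
low (_ , atLeast n) = n

-- Serves the `short` leaves of the search: exact bounds fix the length of the word, and a length of
-- at most 7 contradicts |w| > 7.
exact-length : ∀ {p r} → All IsExact p → Fits p r → length (unrle r) ≡ sum (map low p)
exact-length [] [] = refl
exact-length {r = (x , n) ∷ r} ((c , refl) ∷ ex) ((refl , refl) ∷ fits) =
  trans (length-++ (x ^ c)) (cong₂ _+_ (length-replicate c) (exact-length ex fits))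

-- Search for a cover by good and bad patterns

Good : (Word → Set) → Pattern → Set
Good P g = ∀ {r} → Fits g r → P (unrle r)

Bad : Pattern → Set
Bad p = ∀ {r} → Infix FitsRun p r → unrle r ≢ [] → ¬ AllBRRich (unrle r)

cutPatterns : List Pattern
cutPatterns = map cutPattern cuts

cutPattern-bad : ∀ {e} → ¬ Rich (cutWord e) → Bad (cutPattern e)
cutPattern-bad {e} nr inf w≢[] h = nr (allBRRich-cut e inf w≢[] h)

cutPatterns-bad : All Bad cutPatterns
cutPatterns-bad = All.map⁺ {xs = cuts} {f = cutPattern} (All.map (λ {e} → cutPattern-bad {e}) cuts-notRich)

-- A decision tree whose leaves say why a pattern is settled: it lies inside a good shape, contains
-- a bad pattern, or describes a word that is too short. Whatever tree the search finds is given its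
-- meaning by `covered-sound`.
data Covered (gs bs : List Pattern) : Pattern → Set where
  good  : ∀ {p} → Any (λ g → Pointwise _⊒_ g p) gs → Covered gs bs p
  bad   : ∀ {p} → Any (λ q → Infix _⊒_ q p) bs → Covered gs bs p
  short : ∀ {p} → All IsExact p × sum (map low p) ≤ 7 → Covered gs bs p
  split : ∀ p {x c q} → Covered gs bs (p ++ (x , exactly c) ∷ q) →
          Covered gs bs (p ++ (x , atLeast (suc c)) ∷ q) → Covered gs bs (p ++ (x , atLeast c) ∷ q)

split-fits : ∀ p {x c q r} → Fits (p ++ (x , atLeast c) ∷ q) r →
             Fits (p ++ (x , exactly c) ∷ q) r ⊎ Fits (p ++ (x , atLeast (suc c)) ∷ q) r
split-fits []      ((refl , le) ∷ fits) with m≤n⇒m<n∨m≡n le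
... | inj₁ lt   = inj₂ ((refl , lt) ∷ fits)
... | inj₂ refl = inj₁ ((refl , refl) ∷ fits)
split-fits (_ ∷ p) (fit ∷ fits) with split-fits p fits
... | inj₁ f = inj₁ (fit ∷ f)
... | inj₂ f = inj₂ (fit ∷ f)

covered-sound : ∀ P {gs bs p} → All (Good P) gs → All Bad bs → Covered gs bs p →
                ∀ {r} → Fits p r → 7 < length (unrle r) → AllBRRich (unrle r) → P (unrle r)
covered-sound P goods bads (good i) fits _ _ =
  let (G , sub) = All.lookupAny goods i in G (Pointwise.transitive ⊒-fits sub fits)
covered-sound P goods bads (bad i) fits long h =
  let (B , sub) = All.lookupAny bads i in
  contradiction h (B (Infix-Prefix-trans ⊒-fits sub (fromPointwise fits)) (nonempty long))
  where
  nonempty : ∀ {w : Word} → 7 < length w → w ≢ []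
  nonempty () refl
covered-sound P goods bads (short (ex , le)) fits long _ =
  contradiction (≤-trans (≤-reflexive (exact-length ex fits)) le) (<⇒≱ long)
covered-sound P goods bads (split p c₁ c₂) fits long h with split-fits p fits
... | inj₁ f = covered-sound P goods bads c₁ f long h
... | inj₂ f = covered-sound P goods bads c₂ f long h

data Splittable (c : ℕ) : Pattern → Set where
  splittable : ∀ p x q → Splittable c (p ++ (x , atLeast c) ∷ q)

splittable? : ∀ c p → Maybe (Splittable c p)
splittable? c []      = nothing
splittable? c ((x , exactly n) ∷ p) = mapMaybe (λ { (splittable p′ y q) → splittable (_ ∷ p′) y q }) (splittable? c p)
splittable? c ((x , atLeast n) ∷ p) with c ≟ n
... | yes refl = just (splittable [] x p)
... | no _     = mapMaybe (λ { (splittable p′ y q) → splittable (_ ∷ p′) y q }) (splittable? c p)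

-- Runs are split in order of increasing lower bound c, which keeps the search tree small.
cover : ∀ gs bs (fuel c : ℕ) p → Maybe (Covered gs bs p)
cover-split : ∀ gs bs (fuel c : ℕ) {p} → Maybe (Splittable c p) → Maybe (Covered gs bs p)
cover gs bs zero       c p = nothing
cover gs bs (suc fuel) c p =
  mapMaybe good (dec⇒maybe (any? (λ g → Pointwise.decidable _⊒?_ g p) gs))
  <∣> mapMaybe bad (dec⇒maybe (any? (λ q → infix? _⊒?_ q p) bs))
  <∣> mapMaybe short (dec⇒maybe (all? isExact? p ×-dec sum (map low p) ≤? 7))
  <∣> cover-split gs bs fuel c (splittable? c p)
cover-split gs bs fuel c (just (splittable p x q)) =
  zipMaybe (split p) (cover gs bs fuel c (p ++ (x , exactly c) ∷ q))
                     (cover gs bs fuel c (p ++ (x , atLeast (suc c)) ∷ q))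
cover-split gs bs fuel c {p} nothing = cover gs bs fuel (suc c) p

-- The good patterns

concreteWord : Letter → List ℕ → Word
concreteWord x []       = []
concreteWord x (n ∷ ns) = x ^ n ++ concreteWord (flipL x) ns

fits-exactly : ∀ x ns {r} → Fits (alternating x (map exactly ns)) r → unrle r ≡ concreteWord x ns
fits-exactly x []       []                    = refl
fits-exactly x (n ∷ ns) ((refl , refl) ∷ fits) = cong (x ^ n ++_) (fits-exactly (flipL x) ns fits)

record GoodPattern (P : Word → Set) : Set where
  constructor _is-good_
  field
    shape : Pattern
    sound : Good P shape

open GoodPattern

single : ∀ {P} ns → P (concreteWord a ns) → GoodPattern P
single {P} ns Pw = alternating a (map exactly ns) is-good λ fits → subst P (sym (fits-exactly a ns fits)) Pw

goods8 : List (GoodPattern P8)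
goods8 = single (replicate 8 1) refl ∷ []

goods7 : List (GoodPattern P7)
goods7 = single (1 ∷ 1 ∷ 1 ∷ 1 ∷ 1 ∷ 2 ∷ 1 ∷ []) (inj₁ refl)
       ∷ single (1 ∷ 1 ∷ 1 ∷ 2 ∷ 1 ∷ 1 ∷ 1 ∷ []) (inj₂ (inj₁ refl))
       ∷ single (1 ∷ 2 ∷ 1 ∷ 1 ∷ 1 ∷ 1 ∷ 1 ∷ []) (inj₂ (inj₂ refl))
       ∷ []

reverse-power : ∀ (x : Letter) n → reverse (x ^ n) ≡ x ^ n
reverse-power x zero    = refl
reverse-power x (suc n) = trans (unfold-reverse x (x ^ n))
  (trans (cong (_∷ʳ x) (reverse-power x n))
         (trans (sym (power-+ x n 1)) (cong (x ^_) (+-comm n 1))))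

T-power : ∀ n → 3 ≤ n → T (a ^ n ++ b ^ 1 ++ a ^ 1 ++ b ^ 1 ++ a ^ 1 ++ b ^ 1)
T-power n 3≤n = inj₂ (inj₂ (inj₂ (inj₂ (inj₂ (inj₂ (n , 3≤n , refl))))))

reverse-comp-power : ∀ n → reverse (comp (a ^ n ++ b ^ 1 ++ a ^ 1 ++ b ^ 1 ++ a ^ 1 ++ b ^ 1))
                           ≡ a ∷ b ∷ a ∷ b ∷ a ∷ b ^ n
reverse-comp-power n = begin
  reverse (comp (a ^ n ++ t))                  ≡⟨ cong reverse (map-++ flipL (a ^ n) t) ⟩
  reverse (comp (a ^ n) ++ comp t)             ≡⟨ reverse-++ (comp (a ^ n)) (comp t) ⟩
  reverse (comp t) ++ reverse (comp (a ^ n))   ≡⟨ cong (λ u → reverse (comp t) ++ reverse u) (map-replicate flipL n a) ⟩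
  reverse (comp t) ++ reverse (b ^ n)          ≡⟨ cong (reverse (comp t) ++_) (reverse-power b n) ⟩
  reverse (comp t) ++ b ^ n                    ∎
  where
  open ≡-Reasoning
  t = b ∷ a ∷ b ∷ a ∷ b ∷ []

-- For an even number of runs, the reversed complement again begins with `a` and has the same run
-- lengths in reverse order.
withReverseComp : ∀ ns → T (concreteWord a ns) → concreteWord a (reverse ns) ≡ reverse (comp (concreteWord a ns)) →
       List (GoodPattern P6)
withReverseComp ns t eq = single ns (_ , t , inj₁ refl) ∷ single (reverse ns) (_ , t , inj₂ eq) ∷ []

goods6 : List (GoodPattern P6)
goods6 =
     withReverseComp (1 ∷ 2 ∷ 1 ∷ 1 ∷ 2 ∷ 1 ∷ []) (inj₁ refl) refl
  ++ withReverseComp (1 ∷ 1 ∷ 1 ∷ 2 ∷ 2 ∷ 1 ∷ []) (inj₂ (inj₁ refl)) refl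
  ++ withReverseComp (1 ∷ 1 ∷ 1 ∷ 1 ∷ 2 ∷ 2 ∷ []) (inj₂ (inj₂ (inj₁ refl))) refl
  ++ withReverseComp (2 ∷ 1 ∷ 1 ∷ 2 ∷ 1 ∷ 1 ∷ []) (inj₂ (inj₂ (inj₂ (inj₁ refl)))) refl
  ++ withReverseComp (2 ∷ 1 ∷ 1 ∷ 1 ∷ 1 ∷ 2 ∷ []) (inj₂ (inj₂ (inj₂ (inj₂ (inj₁ refl))))) refl
  ++ withReverseComp (1 ∷ 1 ∷ 2 ∷ 2 ∷ 1 ∷ 1 ∷ []) (inj₂ (inj₂ (inj₂ (inj₂ (inj₂ (inj₁ refl)))))) refl
  ++ ( alternating a (atLeast 3 ∷ one ∷ one ∷ one ∷ one ∷ one ∷ [])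
     is-good λ { ((refl , le) ∷ (refl , refl) ∷ (refl , refl) ∷ (refl , refl) ∷ (refl , refl) ∷ (refl , refl) ∷ []) →
           _ , T-power _ le , inj₁ refl })
   ∷ ( alternating a (one ∷ one ∷ one ∷ one ∷ one ∷ atLeast 3 ∷ [])
     is-good λ { ((refl , refl) ∷ (refl , refl) ∷ (refl , refl) ∷ (refl , refl) ∷ (refl , refl) ∷ (refl , le) ∷ []) →
           _ , T-power _ le ,
           inj₂ (trans (cong (λ u → a ∷ b ∷ a ∷ b ∷ a ∷ u) (++-identityʳ _)) (sym (reverse-comp-power _))) })
   ∷ []
  where one = exactly 1

goods5 : List (GoodPattern P5)
goods5 =
  ( alternating a (atLeast 1 ∷ exactly 1 ∷ atLeast 1 ∷ exactly 1 ∷ atLeast 1 ∷ [])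
  is-good λ { {(_ , n₁) ∷ _ ∷ (_ , n₃) ∷ _ ∷ (_ , n₅) ∷ []}
        ((refl , p) ∷ (refl , refl) ∷ (refl , q) ∷ (refl , refl) ∷ (refl , r) ∷ []) →
        inj₁ (n₁ , n₃ , n₅ , p , q , r ,
              cong (λ u → a ^ n₁ ++ b ∷ a ^ n₃ ++ b ∷ u) (++-identityʳ (a ^ n₅))) })
  ∷ sumFour 1 3 (s≤s z≤n) (s≤s z≤n) refl ++ sumFour 2 2 (s≤s z≤n) (s≤s z≤n) refl
    ++ sumFour 3 1 (s≤s z≤n) (s≤s z≤n) refl
  where
  sumFour : ∀ n₂ n₄ → 1 ≤ n₂ → 1 ≤ n₄ → n₂ + n₄ ≡ 4 → List (GoodPattern P5)
  sumFour n₂ n₄ p q e =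
      single (1 ∷ n₂ ∷ 1 ∷ n₄ ∷ 2 ∷ []) (inj₂ (n₂ , n₄ , p , q , e , inj₁ refl))
    ∷ single (2 ∷ n₂ ∷ 1 ∷ n₄ ∷ 1 ∷ []) (inj₂ (n₂ , n₄ , p , q , e , inj₂ (inj₁ refl)))
    ∷ single (1 ∷ n₂ ∷ 2 ∷ n₄ ∷ 1 ∷ []) (inj₂ (n₂ , n₄ , p , q , e , inj₂ (inj₂ refl)))
    ∷ []

goods4 : List (GoodPattern P4)
goods4 =
  ( alternating a (exactly 1 ∷ atLeast 1 ∷ exactly 1 ∷ atLeast 1 ∷ [])
  is-good λ { {_ ∷ (_ , n₂) ∷ _ ∷ (_ , n₄) ∷ []} ((refl , refl) ∷ (refl , p) ∷ (refl , refl) ∷ (refl , q) ∷ []) →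
        inj₁ (n₂ , n₄ , p , q , cong (λ u → a ∷ b ^ n₂ ++ a ∷ u) (++-identityʳ (b ^ n₄))) })
  ∷ ( alternating a (atLeast 1 ∷ exactly 1 ∷ atLeast 1 ∷ exactly 1 ∷ [])
    is-good λ { ((refl , p) ∷ (refl , refl) ∷ (refl , q) ∷ (refl , refl) ∷ []) →
          inj₂ (inj₁ (_ , _ , p , q , refl)) })
  ∷ concatMap (λ { (n₁ , n₃ , p) → map (λ { (n₂ , n₄ , q) →
        single (n₁ ∷ n₂ ∷ n₃ ∷ n₄ ∷ []) (inj₂ (inj₂ (n₁ , n₂ , n₃ , n₄ , q , p ,
          cong (λ u → a ^ n₁ ++ b ^ n₂ ++ a ^ n₃ ++ u) (++-identityʳ (b ^ n₄))))) }) pairs31 }) pairs31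
  where
  pairs31 : List (∃[ x ] ∃[ y ] Pair31 x y)
  pairs31 = (3 , 1 , inj₁ (refl , refl)) ∷ (2 , 2 , inj₂ (inj₁ (refl , refl)))
          ∷ (1 , 3 , inj₂ (inj₂ (refl , refl))) ∷ []

goods3 : List (GoodPattern P3)
goods3 =
    single (2 ∷ 4 ∷ 2 ∷ []) (inj₁ refl)
  ∷ ( alternating a (exactly 1 ∷ atLeast 1 ∷ exactly 1 ∷ [])
    is-good λ { ((refl , refl) ∷ (refl , p) ∷ (refl , refl) ∷ []) → inj₂ (inj₁ (_ , p , refl)) })
  ∷ ( alternating a (atLeast 1 ∷ exactly 1 ∷ atLeast 1 ∷ [])
    is-good λ { {(_ , n₁) ∷ _ ∷ (_ , n₃) ∷ []} ((refl , p) ∷ (refl , refl) ∷ (refl , q) ∷ []) →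
          inj₂ (inj₂ (inj₁ (n₁ , n₃ , p , q , dropNil n₁ (b ^ 1) n₃))) })
  ∷ ( alternating a (atLeast 1 ∷ exactly 2 ∷ atLeast 1 ∷ [])
    is-good λ { {(_ , n₁) ∷ _ ∷ (_ , n₃) ∷ []} ((refl , p) ∷ (refl , refl) ∷ (refl , q) ∷ []) →
          inj₂ (inj₂ (inj₂ (inj₁ (n₁ , n₃ , p , q , dropNil n₁ (b ^ 2) n₃)))) })
  ∷ middle 3 (inj₁ refl) ++ middle 4 (inj₂ refl)
  where
  dropNil : ∀ n₁ u n₃ → a ^ n₁ ++ u ++ a ^ n₃ ++ [] ≡ a ^ n₁ ++ u ++ a ^ n₃
  dropNil n₁ u n₃ = cong (λ v → a ^ n₁ ++ u ++ v) (++-identityʳ (a ^ n₃))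
  middle : ∀ n₂ → n₂ ≡ 3 ⊎ n₂ ≡ 4 → List (GoodPattern P3)
  middle n₂ n₂∈ =
      ( alternating a (exactly 1 ∷ exactly n₂ ∷ atLeast 3 ∷ [])
      is-good λ { {_ ∷ _ ∷ (_ , n₃) ∷ []} ((refl , refl) ∷ (refl , refl) ∷ (refl , p) ∷ []) →
            inj₂ (inj₂ (inj₂ (inj₂ (inj₁ (n₂ , n₃ , n₂∈ , p , dropNil 1 (b ^ n₂) n₃))))) })
    ∷ ( alternating a (atLeast 3 ∷ exactly n₂ ∷ exactly 1 ∷ [])
      is-good λ { ((refl , p) ∷ (refl , refl) ∷ (refl , refl) ∷ []) →
            inj₂ (inj₂ (inj₂ (inj₂ (inj₂ (_ , n₂ , n₂∈ , p , refl))))) })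
    ∷ []

-- Necessity from the cover certificates

AllCovered : ∀ {P} → List (GoodPattern P) → ℕ → Set
AllCovered gs k = Covered (map shape gs) cutPatterns (alternating a (replicate k (atLeast 1)))

allCovered? : ∀ {P} (gs : List (GoodPattern P)) k → Maybe (AllCovered gs k)
-- The fuel 30 bounds the depth of the tree; that it suffices is confirmed when the `from-just`
-- terms below type-check.
allCovered? gs k = cover (map shape gs) cutPatterns 30 1 (alternating a (replicate k (atLeast 1)))

rle-comp : ∀ w → rle (comp w) ≡ map (map₁ flipL) (rle w)
rle-comp []      = refl
rle-comp (x ∷ w) = trans (cong (consRun (flipL x)) (rle-comp w)) (consRun-flip x (rle w))
  where
  consRun-flip : ∀ x r → consRun (flipL x) (map (map₁ flipL) r) ≡ map (map₁ flipL) (consRun x r)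
  consRun-flip x []            = refl
  consRun-flip a ((a , _) ∷ _) = refl
  consRun-flip a ((b , _) ∷ _) = refl
  consRun-flip b ((a , _) ∷ _) = refl
  consRun-flip b ((b , _) ∷ _) = refl

l-comp : ∀ w → l (comp w) ≡ l w
l-comp w = trans (cong length (rle-comp w)) (length-map (map₁ flipL) (rle w))

necessary-a : ∀ {k P} (gs : List (GoodPattern P)) → AllCovered gs k →
              ∀ w → 7 < length (a ∷ w) → l (a ∷ w) ≡ k → AllBRRich (a ∷ w) → P (a ∷ w)
necessary-a {P = P} gs cov w long refl h = subst P eq
  (covered-sound P (All.map⁺ (All.universal sound gs)) cutPatterns-bad cov (rle-fits a w)
    (subst (λ u → 7 < length u) (sym eq) long) (subst AllBRRich (sym eq) h))
  where eq = unrle-rle (a ∷ w)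

necessary : ∀ {k P} (gs : List (GoodPattern P)) → AllCovered gs k →
            ∀ w → 7 < length w → l w ≡ k → AllBRRich w → UpToSwap P w
necessary gs cov (a ∷ w) long lw h = inj₁ (necessary-a gs cov w long lw h)
necessary gs cov (b ∷ w) long lw h =
  inj₂ (necessary-a gs cov (comp w) (subst (7 <_) (sym (length-map flipL (b ∷ w))) long)
                    (trans (l-comp (b ∷ w)) lw) (allBRRich-comp h))

covered8 : AllCovered goods8 8
covered8 = from-just (allCovered? goods8 8)

covered7 : AllCovered goods7 7
covered7 = from-just (allCovered? goods7 7)

covered6 : AllCovered goods6 6
covered6 = from-just (allCovered? goods6 6)

covered5 : AllCovered goods5 5
covered5 = from-just (allCovered? goods5 5)

covered4 : AllCovered goods4 4
covered4 = from-just (allCovered? goods4 4)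

covered3 : AllCovered goods3 3
covered3 = from-just (allCovered? goods3 3)

-- Words given by the gaps between consecutive b's

tailWord : List ℕ → Word
tailWord []       = []
tailWord (g ∷ gs) = b ∷ a ^ g ++ tailWord gs

gapWord : ℕ → List ℕ → Word
gapWord g gs = a ^ g ++ tailWord gs

tailWord-++ : ∀ c d → tailWord (c ++ d) ≡ tailWord c ++ tailWord d
tailWord-++ []      d = refl
tailWord-++ (g ∷ c) d = cong (b ∷_) (trans (cong (a ^ g ++_) (tailWord-++ c d)) (sym (++-assoc (a ^ g) _ _)))

-- `tailWord c` has a b before each gap, its reversal a b after each gap; one additional b at the
-- front, respectively at the end, makes the two sides agree.
reverse-tailWord : ∀ c → b ∷ reverse (tailWord c) ≡ tailWord (reverse c) ++ [ b ]
reverse-tailWord []      = refl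
reverse-tailWord (g ∷ c) = begin
  b ∷ reverse ((b ∷ a ^ g) ++ tailWord c)              ≡⟨ cong (b ∷_) (reverse-++ (b ∷ a ^ g) (tailWord c)) ⟩
  b ∷ reverse (tailWord c) ++ reverse (b ∷ a ^ g)      ≡⟨ cong₂ _++_ (reverse-tailWord c) (unfold-reverse b (a ^ g)) ⟩
  (tailWord (reverse c) ++ [ b ]) ++ reverse (a ^ g) ∷ʳ b
    ≡⟨ cong (λ u → (tailWord (reverse c) ++ [ b ]) ++ u ∷ʳ b) (reverse-power a g) ⟩
  (tailWord (reverse c) ++ [ b ]) ++ a ^ g ∷ʳ b        ≡⟨ ++-assoc (tailWord (reverse c)) [ b ] _ ⟩
  tailWord (reverse c) ++ (b ∷ a ^ g) ++ [ b ]         ≡⟨ ++-assoc (tailWord (reverse c)) (b ∷ a ^ g) _ ⟨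
  (tailWord (reverse c) ++ b ∷ a ^ g) ++ [ b ]
    ≡⟨ cong (λ u → (tailWord (reverse c) ++ b ∷ u) ++ [ b ]) (++-identityʳ (a ^ g)) ⟨
  (tailWord (reverse c) ++ tailWord [ g ]) ++ [ b ]    ≡⟨ cong (_++ [ b ]) (tailWord-++ (reverse c) [ g ]) ⟨
  tailWord (reverse c ∷ʳ g) ++ [ b ]                   ≡⟨ cong (λ d → tailWord d ++ [ b ]) (unfold-reverse g c) ⟨
  tailWord (reverse (g ∷ c)) ++ [ b ]                  ∎
  where open ≡-Reasoning

-- A `gapList` is never empty, so the first clause is a default.
bump : List ℕ → List ℕ
bump []       = []
bump (g ∷ gs) = suc g ∷ gs

gapList : Word → List ℕ
gapList []      = 0 ∷ []
gapList (a ∷ w) = bump (gapList w)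
gapList (b ∷ w) = 0 ∷ gapList w

gapList-power : ∀ n w {g gs} → gapList w ≡ g ∷ gs → gapList (a ^ n ++ w) ≡ n + g ∷ gs
gapList-power zero    w eq = eq
gapList-power (suc n) w eq = cong bump (gapList-power n w eq)

gapList-tailWord : ∀ gs → gapList (tailWord gs) ≡ 0 ∷ gs
gapList-tailWord []       = refl
gapList-tailWord (g ∷ gs) = cong (0 ∷_)
  (trans (gapList-power g (tailWord gs) (gapList-tailWord gs)) (cong (_∷ gs) (+-identityʳ g)))

gapList-gapWord : ∀ g gs → gapList (gapWord g gs) ≡ g ∷ gs
gapList-gapWord g gs =
  trans (gapList-power g (tailWord gs) (gapList-tailWord gs)) (cong (_∷ gs) (+-identityʳ g))

gapView : ∀ w → ∃[ g ] ∃[ gs ] (gapList w ≡ g ∷ gs × w ≡ gapWord g gs)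
gapView []      = 0 , [] , refl , refl
gapView (a ∷ w) = let (g , gs , e , f) = gapView w in suc g , gs , cong bump e , cong (a ∷_) f
gapView (b ∷ w) = let (g , gs , e , f) = gapView w in 0 , g ∷ gs , cong (0 ∷_) e , cong (b ∷_) f

-- Follows i c and Occurs i c describe occurrences of a^i b a^c₁ b ⋯ b a^cₙ b a^i in terms of gaps.

data Follows (i : ℕ) : List ℕ → List ℕ → Set where
  end  : ∀ {h gs} → i ≤ h → Follows i [] (h ∷ gs)
  step : ∀ {x y c gs} → x ≡ y → Follows i c gs → Follows i (x ∷ c) (y ∷ gs)

data Occurs (i : ℕ) (c : List ℕ) : List ℕ → Set where
  here  : ∀ {g gs} → i ≤ g → Follows i c gs → Occurs i c (g ∷ gs)
  there : ∀ {g gs} → Occurs i c gs → Occurs i c (g ∷ gs)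

follows? : ∀ i c gs → Dec (Follows i c gs)
follows? i []      []       = no λ ()
follows? i []      (h ∷ gs) = map′ end (λ { (end le) → le }) (i ≤? h)
follows? i (x ∷ c) []       = no λ ()
follows? i (x ∷ c) (y ∷ gs) =
  map′ (λ { (e , f) → step e f }) (λ { (step e f) → e , f }) (x ≟ y ×-dec follows? i c gs)

occurs? : ∀ i c gs → Dec (Occurs i c gs)
occurs? i c []       = no λ ()
occurs? i c (g ∷ gs) =
  map′ [ (λ { (le , f) → here le f }) , there ]′ (λ { (here le f) → inj₁ (le , f) ; (there o) → inj₂ o })
       ((i ≤? g ×-dec follows? i c gs) ⊎-dec occurs? i c gs)

-- For a non-empty word `a ^ i ++ tailWord gs`, this provides a palindromic prefix that is absent
-- once the first letter is removed: either `a ^ i`, or a^i b a^c₁ b ⋯ b a^i. The first letter is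
-- `a` for positive `i` and `b` for `i` = 0; after removing an `a`, the first gap is too short for
-- the opening run, so one condition on `gs` serves both letters.
New : ℕ → List ℕ → Set
New i gs = All (_< i) gs ⊎ ∃[ c ] (Prefix c gs × reverse c ≡ c × Follows i c gs × ¬ Occurs i c gs)

new? : ∀ i gs → Dec (New i gs)
new? i gs = all? (_<? i) gs ⊎-dec
  anyPrefix? (λ c → ≡-dec _≟_ (reverse c) c ×-dec follows? i c gs ×-dec ¬? (occurs? i c gs)) gs

-- Only the heights x ⊓ g with x a later gap matter: between two of them New i gs is constant in i.
GapRich : List ℕ → Set
GapRich []       = ⊤
GapRich (g ∷ gs) = GapRich gs × All (λ x → New (x ⊓ g) gs) gs

gapRich? : ∀ gs → Dec (GapRich gs)
gapRich? []       = yes tt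
gapRich? (g ∷ gs) = gapRich? gs ×-dec all? (λ x → new? (x ⊓ g) gs) gs

follows-prefix : ∀ {i c gs} → Follows i c gs → Prefix c gs
follows-prefix (end _)       = _ , refl
follows-prefix (step refl f) = let (v , e) = follows-prefix f in v , cong (_ ∷_) e

follows-lower : ∀ {i j c gs} → i ≤ j → Follows j c gs → Follows i c gs
follows-lower i≤j (end le)   = end (≤-trans i≤j le)
follows-lower i≤j (step e f) = step e (follows-lower i≤j f)

follows-raise : ∀ {i j c gs} → All (λ y → i ≤ y → j ≤ y) gs → Follows i c gs → Follows j c gs
follows-raise (up ∷ _)  (end le)   = end (up le)
follows-raise (_ ∷ ups) (step e f) = step e (follows-raise ups f)

occurs-raise : ∀ {i j c gs} → All (λ y → i ≤ y → j ≤ y) gs → Occurs i c gs → Occurs j c gs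
occurs-raise (up ∷ ups) (here le f) = here (up le) (follows-raise ups f)
occurs-raise (_ ∷ ups)  (there o)   = there (occurs-raise ups o)

-- Shortening the end runs from `j` to `i` could create further occurrences. As no gap lies in [i,
-- j), every occurrence at height `i` is already one at height `j`.
new-lower : ∀ {i j gs} → i ≤ j → All (λ y → i ≤ y → j ≤ y) gs → New j gs → New i gs
new-lower i≤j ups (inj₁ below) =
  inj₁ (All.zipWith (λ { (up , y<j) → ≰⇒> (λ i≤y → <⇒≱ y<j (up i≤y)) }) (ups , below))
new-lower i≤j ups (inj₂ (c , pre , pal , f , ¬o)) =
  inj₂ (c , pre , pal , follows-lower i≤j f , λ o → ¬o (occurs-raise ups o))

least-above : ∀ i gs → All (_< i) gs ⊎ ∃[ x ] (x ∈ gs × i ≤ x × All (λ y → i ≤ y → x ≤ y) gs)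
least-above i [] = inj₁ []
least-above i (g ∷ gs) with i ≤? g | least-above i gs
... | no i≰g  | inj₁ below            = inj₁ (≰⇒> i≰g ∷ below)
... | no i≰g  | inj₂ (x , x∈ , le , least) = inj₂ (x , there x∈ , le , (λ i≤g → contradiction i≤g i≰g) ∷ least)
... | yes i≤g | inj₁ below            =
  inj₂ (g , here refl , i≤g , (λ _ → ≤-refl) ∷ All.map (λ y<i i≤y → contradiction i≤y (<⇒≱ y<i)) below)
... | yes i≤g | inj₂ (x , x∈ , le , least) with ≤-total g x
...   | inj₁ g≤x = inj₂ (g , here refl , i≤g , (λ _ → ≤-refl) ∷ All.map (λ up i≤y → ≤-trans g≤x (up i≤y)) least)
...   | inj₂ x≤g = inj₂ (x , there x∈ , le , (λ _ → x≤g) ∷ least)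

-- Let x be the least later gap that is ≥ i. No later gap lies in [i, x), so `New` descends from x ⊓
-- g to i. If there is no such x, then `a ^ i` itself is new.
new-all : ∀ {g gs} → All (λ x → New (x ⊓ g) gs) gs → ∀ {i} → i ≤ g → New i gs
new-all {g} {gs} news {i} i≤g with least-above i gs
... | inj₁ below                  = inj₁ below
... | inj₂ (x , x∈ , i≤x , least) = new-lower (⊓-glb i≤x i≤g)
        (All.map (λ up i≤y → ≤-trans (m⊓n≤m x g) (up i≤y)) least) (All.lookup news x∈)

occurs-bump : ∀ {i c gs} → Occurs i c gs → Occurs i c (bump gs)
occurs-bump (here le f) = here (m≤n⇒m≤1+n le) f
occurs-bump (there o)   = there o

gapPalindrome : ℕ → List ℕ → Word
gapPalindrome i c = a ^ i ++ tailWord c ++ b ∷ a ^ i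

gapPalindrome-palindrome : ∀ i {c} → reverse c ≡ c → IsPalindrome (gapPalindrome i c)
gapPalindrome-palindrome i {c} pal = begin
  reverse (a ^ i ++ tailWord c ++ b ∷ a ^ i)
    ≡⟨ reverse-++ (a ^ i) _ ⟩
  reverse (tailWord c ++ b ∷ a ^ i) ++ reverse (a ^ i)
    ≡⟨ cong₂ _++_ (reverse-++ (tailWord c) (b ∷ a ^ i)) (reverse-power a i) ⟩
  (reverse (b ∷ a ^ i) ++ reverse (tailWord c)) ++ a ^ i
    ≡⟨ cong (λ u → (u ++ reverse (tailWord c)) ++ a ^ i)
            (trans (unfold-reverse b (a ^ i)) (cong (_∷ʳ b) (reverse-power a i))) ⟩
  ((a ^ i ∷ʳ b) ++ reverse (tailWord c)) ++ a ^ i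
    ≡⟨ cong (_++ a ^ i) (++-assoc (a ^ i) [ b ] _) ⟩
  (a ^ i ++ b ∷ reverse (tailWord c)) ++ a ^ i
    ≡⟨ cong (λ u → (a ^ i ++ u) ++ a ^ i) (trans (reverse-tailWord c) (cong (λ d → tailWord d ++ [ b ]) pal)) ⟩
  (a ^ i ++ tailWord c ++ [ b ]) ++ a ^ i
    ≡⟨ trans (++-assoc (a ^ i) _ _) (cong (a ^ i ++_) (++-assoc (tailWord c) [ b ] _)) ⟩
  a ^ i ++ tailWord c ++ b ∷ a ^ i ∎
  where open ≡-Reasoning

gapPalindrome-prefix : ∀ {i c gs} → Follows i c gs → Prefix (gapPalindrome i c) (gapWord i gs)
gapPalindrome-prefix {i} f = let (v , e) = go f in
  v , trans (++-assoc (a ^ i) _ v) (cong (a ^ i ++_) e)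
  where
  go : ∀ {c gs} → Follows i c gs → Prefix (tailWord c ++ b ∷ a ^ i) (tailWord gs)
  go (end {h} {gs} le) = a ^ (h ∸ i) ++ tailWord gs , cong (b ∷_) (trans (sym (++-assoc (a ^ i) (a ^ (h ∸ i)) _))
    (cong (_++ tailWord gs) (trans (sym (power-+ a i (h ∸ i))) (cong (a ^_) (m+[n∸m]≡n le)))))
  go (step {x} {c = c} refl f) = let (v , e) = go f in
    v , cong (b ∷_) (trans (cong (_++ v) (++-assoc (a ^ x) (tailWord c) _))
                    (trans (++-assoc (a ^ x) _ v) (cong (a ^ x ++_) e)))

factor-occurs : ∀ {i c w} → Factor (gapPalindrome i c) w → Occurs i c (gapList w)
factor-occurs (a ∷ u , v , refl) = occurs-bump (factor-occurs (u , v , refl))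
factor-occurs (b ∷ u , v , refl) = there (factor-occurs (u , v , refl))
factor-occurs {i} {c} ([] , v , refl) =
  let (gs , e , f) = follows-tail c in
  subst (Occurs i c) (sym (trans (cong gapList eq) (gapList-power i _ e))) (here (m≤m+n i 0) f)
  where
  eq : (a ^ i ++ tailWord c ++ b ∷ a ^ i) ++ v ≡ a ^ i ++ tailWord c ++ b ∷ a ^ i ++ v
  eq = trans (++-assoc (a ^ i) _ v) (cong (a ^ i ++_) (++-assoc (tailWord c) _ v))
  follows-tail : ∀ c → ∃[ gs ] (gapList (tailWord c ++ b ∷ a ^ i ++ v) ≡ 0 ∷ gs × Follows i c gs)
  follows-tail []      = let (g , gs , e , _) = gapView v in
    i + g ∷ gs , cong (0 ∷_) (gapList-power i v e) , end (m≤m+n i g)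
  follows-tail (x ∷ c) = let (gs , e , f) = follows-tail c in
    x + 0 ∷ gs , cong (0 ∷_) (trans (cong gapList (++-assoc (a ^ x) (tailWord c) _)) (gapList-power x _ e)) ,
    step (sym (+-identityʳ x)) f

power-factor : ∀ {i w} → Factor (a ^ i) w → Any (i ≤_) (gapList w)
power-factor (b ∷ u , v , refl) = there (power-factor (u , v , refl))
power-factor (a ∷ u , v , refl) = any-bump (power-factor (u , v , refl))
  where
  any-bump : ∀ {i gs} → Any (i ≤_) gs → Any (i ≤_) (bump gs)
  any-bump (here le) = here (m≤n⇒m≤1+n le)
  any-bump (there p) = there p
power-factor {i} ([] , v , refl) = let (g , gs , e , _) = gapView v in
  subst (Any (i ≤_)) (sym (gapList-power i v e)) (here (m≤m+n i g))

gapPalindrome≢[] : ∀ i c → gapPalindrome i c ≢ []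
gapPalindrome≢[] zero    []      ()
gapPalindrome≢[] zero    (_ ∷ _) ()
gapPalindrome≢[] (suc i) c       ()

new-a : ∀ {g gs} → New (suc g) gs → ∃ (NewPal a (gapWord g gs))
new-a {g} {gs} (inj₁ below) = a ^ suc g , (λ ()) , reverse-power a (suc g) , (tailWord gs , refl) , notFactor
  where
  notFactor : ¬ Factor (a ^ suc g) (gapWord g gs)
  notFactor f with subst (Any (suc g ≤_)) (gapList-gapWord g gs) (power-factor f)
  ... | here le = 1+n≰n le
  ... | there p = let (y<g , g<y) = All.lookupAny below p in <⇒≱ y<g g<y
new-a {g} {gs} (inj₂ (c , _ , pal , f , ¬o)) =
  gapPalindrome (suc g) c , (λ ()) , gapPalindrome-palindrome (suc g) pal , gapPalindrome-prefix f , notFactor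
  where
  notFactor : ¬ Factor (gapPalindrome (suc g) c) (gapWord g gs)
  notFactor fac with subst (Occurs (suc g) c) (gapList-gapWord g gs) (factor-occurs fac)
  -- The first gap is `g`, one short of the opening run.
  ... | here le _ = 1+n≰n le
  ... | there o   = ¬o o

new-b : ∀ {h hs} → New 0 (h ∷ hs) → ∃ (NewPal b (gapWord h hs))
new-b (inj₁ (() ∷ _))
new-b {h} {hs} (inj₂ (c , _ , pal , f , ¬o)) =
  gapPalindrome 0 c , gapPalindrome≢[] 0 c , gapPalindrome-palindrome 0 pal , gapPalindrome-prefix f ,
  λ fac → ¬o (subst (Occurs 0 c) (gapList-gapWord h hs) (factor-occurs fac))

-- The word grows from right to left: each b is prepended at height 0, and the a's of a gap at
-- heights 1, 2, up to that gap. `new-all` supplies a new palindrome at every height.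
gapRich-gapWord : ∀ g gs → GapRich (g ∷ gs) → Rich (gapWord g gs)
gapRich-gapWord g gs (rest , news) = grow g (λ i≤g → new-all news i≤g)
  where
  start : ∀ gs → GapRich gs → New 0 gs → Rich (tailWord gs)
  start []       _ _   = rich-[]
  start (h ∷ hs) r new = rich-cons (gapRich-gapWord h hs r) (proj₂ (new-b new))
  grow : ∀ g → (∀ {i} → i ≤ g → New i gs) → Rich (gapWord g gs)
  grow zero    new = start gs rest (new z≤n)
  grow (suc g) new = rich-cons (grow g (λ le → new (m≤n⇒m≤1+n le))) (proj₂ (new-a (new ≤-refl)))

gapRich-rich : ∀ w → GapRich (gapList w) → Rich w
gapRich-rich w r = let (g , gs , e , f) = gapView w in
  subst Rich (sym f) (gapRich-gapWord g gs (subst GapRich e r))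

-- GapRich depends only on the relative order of the gaps

module _ {f : ℕ → ℕ} (f-mono : ∀ {i j} → i < j → f i < f j) where

  mono-≤ : ∀ {i j} → i ≤ j → f i ≤ f j
  mono-≤ i≤j with m≤n⇒m<n∨m≡n i≤j
  ... | inj₁ i<j  = <⇒≤ (f-mono i<j)
  ... | inj₂ refl = ≤-refl

  mono-≤⁻ : ∀ {i j} → f i ≤ f j → i ≤ j
  mono-≤⁻ {i} {j} le = ≮⇒≥ (λ j<i → <⇒≱ (f-mono j<i) le)

  mono-injective : ∀ {i j} → f i ≡ f j → i ≡ j
  mono-injective e = ≤-antisym (mono-≤⁻ (≤-reflexive e)) (mono-≤⁻ (≤-reflexive (sym e)))

  follows-map : ∀ {i c gs} → Follows i c gs → Follows (f i) (map f c) (map f gs)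
  follows-map (end le)     = end (mono-≤ le)
  follows-map (step e fol) = step (cong f e) (follows-map fol)

  -- `New` contains the negative condition that a palindrome does not occur, so occurrences must be
  -- reflected by `f` and not only preserved.
  follows-map⁻ : ∀ {i} c gs → Follows (f i) (map f c) (map f gs) → Follows i c gs
  follows-map⁻ []      (h ∷ gs) (end le)     = end (mono-≤⁻ le)
  follows-map⁻ (x ∷ c) (y ∷ gs) (step e fol) = step (mono-injective e) (follows-map⁻ c gs fol)

  occurs-map⁻ : ∀ {i} c gs → Occurs (f i) (map f c) (map f gs) → Occurs i c gs
  occurs-map⁻ c (g ∷ gs) (here le fol) = here (mono-≤⁻ le) (follows-map⁻ c gs fol)
  occurs-map⁻ c (g ∷ gs) (there o)     = there (occurs-map⁻ c gs o)

  new-map : ∀ {i gs} → New i gs → New (f i) (map f gs)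
  new-map (inj₁ below) = inj₁ (All.map⁺ (All.map f-mono below))
  new-map {gs = gs} (inj₂ (c , _ , pal , fol , ¬o)) =
    inj₂ (map f c , follows-prefix (follows-map fol) , trans (sym (reverse-map f c)) (cong (map f) pal) ,
          follows-map fol , λ o → ¬o (occurs-map⁻ c gs o))

  gapRich-map : ∀ gs → GapRich gs → GapRich (map f gs)
  gapRich-map []       _             = tt
  gapRich-map (g ∷ gs) (rest , news) = gapRich-map gs rest , All.map⁺ (All.map
    (λ {x} new → subst (λ i → New i (map f gs)) (mono-≤-distrib-⊓ mono-≤ x g) (new-map new)) news)

-- At most two occurrences of a letter

bCount : Word → ℕ
bCount []      = 0
bCount (a ∷ w) = bCount w
bCount (b ∷ w) = suc (bCount w)

bCount-++ : ∀ u v → bCount (u ++ v) ≡ bCount u + bCount v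
bCount-++ []      v = refl
bCount-++ (a ∷ u) v = bCount-++ u v
bCount-++ (b ∷ u) v = cong suc (bCount-++ u v)

bCount-power : ∀ n → bCount (a ^ n) ≡ 0
bCount-power zero    = refl
bCount-power (suc n) = bCount-power n

bCount-power-++ : ∀ n w → bCount (a ^ n ++ w) ≡ bCount w
bCount-power-++ n w = trans (bCount-++ (a ^ n) w) (cong (_+ bCount w) (bCount-power n))

bCount-tailWord : ∀ gs → bCount (tailWord gs) ≡ length gs
bCount-tailWord []       = refl
bCount-tailWord (g ∷ gs) = cong suc (trans (bCount-power-++ g _) (bCount-tailWord gs))

bCount-reversal : ∀ {w v} → Reversal w v → bCount v ≡ bCount w
bCount-reversal []           = refl
bCount-reversal (step x B {s} {v} r) = begin
  bCount (v ++ x ∷ B)          ≡⟨ bCount-++ v (x ∷ B) ⟩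
  bCount v + bCount (x ∷ B)    ≡⟨ cong (_+ bCount (x ∷ B)) (bCount-reversal r) ⟩
  bCount s + bCount (x ∷ B)    ≡⟨ +-comm (bCount s) _ ⟩
  bCount (x ∷ B) + bCount s    ≡⟨ bCount-++ (x ∷ B) s ⟨
  bCount (x ∷ B ++ s)          ∎
  where open ≡-Reasoning

new-one : ∀ {i} y → i ≤ y → New i (y ∷ [])
new-one y i≤y = inj₂ ([] , (_ , refl) , refl , end i≤y , λ { (here _ ()) ; (there ()) })

-- The palindrome reaches past the second b if `i` ≤ z; it is a^i b a^i if only the first of the two
-- gaps is long enough; otherwise it is `a ^ i`. In the first two cases too few b's, or too short a
-- last gap, remain for another occurrence.
new-two : ∀ i y z → New i (y ∷ z ∷ [])
new-two i y z with i ≤? z | i ≤? y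
... | yes i≤z | _       = inj₂ (y ∷ [] , (_ , refl) , refl , step refl (end i≤z) ,
                                λ { (here _ (step _ ())) ; (there (here _ ())) ; (there (there ())) })
... | no i≰z  | yes i≤y = inj₂ ([] , (_ , refl) , refl , end i≤y ,
                                λ { (here _ (end i≤z)) → i≰z i≤z ; (there (here _ ())) ; (there (there ())) })
... | no i≰z  | no i≰y  = inj₁ (≰⇒> i≰y ∷ ≰⇒> i≰z ∷ [])

gapRich-≤2 : ∀ g gs → length gs ≤ 2 → GapRich (g ∷ gs)
gapRich-≤2 g []           _ = tt , []
gapRich-≤2 g (y ∷ [])     _ = (tt , []) , new-one y (m⊓n≤m y g) ∷ []
gapRich-≤2 g (y ∷ z ∷ []) _ =
  gapRich-≤2 y (z ∷ []) (s≤s z≤n) , new-two (y ⊓ g) y z ∷ new-two (z ⊓ g) y z ∷ []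
gapRich-≤2 g (_ ∷ _ ∷ _ ∷ _) (s≤s (s≤s ()))

bCount≤2-rich : ∀ w → bCount w ≤ 2 → Rich w
bCount≤2-rich w le = let (g , gs , _ , f) = gapView w in
  subst Rich (sym f) (gapRich-gapWord g gs (gapRich-≤2 g gs (subst (_≤ 2)
    (trans (cong bCount f) (trans (bCount-power-++ g _) (bCount-tailWord gs))) le)))

allBRRich-≤2 : ∀ {w} → bCount w ≤ 2 → AllBRRich w
allBRRich-≤2 le v v∈ = bCount≤2-rich v (subst (_≤ 2) (sym (bCount-reversal (∈BR⇒reversal v∈))) le)

-- A power of a followed by a fixed word

-- Opens room between the gaps 2 and 3 and between the gaps 5 and 6.
stretch : ℕ → ℕ → ℕ → ℕ
stretch k m 0 = 0
stretch k m 1 = 1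
stretch k m 2 = 2
stretch k m 3 = k
stretch k m 4 = 1 + k
stretch k m 5 = 2 + k
stretch k m (suc (suc (suc (suc (suc (suc g)))))) = g + m

stretch-mono : ∀ {k m} → 3 ≤ k → 3 + k ≤ m → ∀ {i j} → i < j → stretch k m i < stretch k m j
stretch-mono {k} {m} 3≤k k+3≤m = mono
  where
  f = stretch k m
  next : ∀ i → f i < f (suc i)
  next 0 = s≤s z≤n
  next 1 = s≤s (s≤s z≤n)
  next 2 = 3≤k
  next 3 = ≤-refl
  next 4 = ≤-refl
  next 5 = k+3≤m
  next (suc (suc (suc (suc (suc (suc g)))))) = ≤-refl
  mono : ∀ {i j} → i < j → f i < f j
  mono {i} {suc j} i<1+j with m≤n⇒m<n∨m≡n (s≤s⁻¹ i<1+j)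
  ... | inj₁ i<j  = <-trans (mono i<j) (next j)
  ... | inj₂ refl = next i

-- `Q` holds of the leading gap whenever an `a` is prepended. With `Q` excluding the gaps at which
-- `stretch` jumps, stretching the gaps commutes with prepending `u`.
Extends : (ℕ → Set) → Word → Word → Set
Extends Q []      w = ⊤
Extends Q (a ∷ u) w = All Q (take 1 (gapList (u ++ w))) × Extends Q u w
Extends Q (b ∷ u) w = Extends Q u w

extends? : ∀ {Q} → (∀ g → Dec (Q g)) → ∀ u w → Dec (Extends Q u w)
extends? Q? []      w = yes tt
extends? Q? (a ∷ u) w = all? Q? (take 1 (gapList (u ++ w))) ×-dec extends? Q? u w
extends? Q? (b ∷ u) w = extends? Q? u w

map-extends : ∀ {f Q} → f 0 ≡ 0 → (∀ {g} → Q g → f (suc g) ≡ suc (f g)) → ∀ u {w w′} → Extends Q u w →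
              map f (gapList w) ≡ gapList w′ → map f (gapList (u ++ w)) ≡ gapList (u ++ w′)
map-extends f0 fs []      _         e = e
map-extends f0 fs (b ∷ u) ext       e = cong₂ _∷_ f0 (map-extends f0 fs u ext e)
map-extends {f} f0 fs (a ∷ u) {w} (q , ext) e =
  trans (map-bump (gapList (u ++ w)) q) (cong bump (map-extends f0 fs u ext e))
  where
  map-bump : ∀ gs → All _ (take 1 gs) → map f (bump gs) ≡ bump (map f gs)
  map-bump []       _       = refl
  map-bump (g ∷ gs) (q ∷ _) = cong (_∷ map f gs) (fs q)

-- The jumps of `stretch k m` are from 2 to 3 and from 5 to 6; for k = 3 the first one is an
-- ordinary step.
NotFive NotTwoFive : ℕ → Set
NotFive g    = g ≢ 5
NotTwoFive g = g ≢ 2 × g ≢ 5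

stretch-suc : ∀ {k m g} → NotTwoFive g → stretch k m (suc g) ≡ suc (stretch k m g)
stretch-suc {g = 0} _         = refl
stretch-suc {g = 1} _         = refl
stretch-suc {g = 2} (ne , _)  = contradiction refl ne
stretch-suc {g = 3} _         = refl
stretch-suc {g = 4} _         = refl
stretch-suc {g = 5} (_ , ne)  = contradiction refl ne
stretch-suc {g = suc (suc (suc (suc (suc (suc g)))))} _ = refl

stretch₃-suc : ∀ {m g} → NotFive g → stretch 3 m (suc g) ≡ suc (stretch 3 m g)
stretch₃-suc {g = 2} _ = refl
stretch₃-suc {g = 0} _ = refl
stretch₃-suc {g = 1} _ = refl
stretch₃-suc {g = 3} _ = refl
stretch₃-suc {g = 4} _ = refl
stretch₃-suc {g = 5} ne = contradiction refl ne
stretch₃-suc {g = suc (suc (suc (suc (suc (suc g)))))} _ = refl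

gapList-a^ : ∀ n → gapList (a ^ n) ≡ n ∷ []
gapList-a^ n = trans (cong gapList (sym (++-identityʳ (a ^ n)))) (gapList-gapWord n [])

Small : Word → Set
Small u = Extends NotFive u (a ^ 6) × GapRich (gapList (u ++ a ^ 6))

-- A longer final power only extends the word to the right, so it may be assumed at least 6; then
-- one sample with `a ^ 6` represents all of them.
small-rich : ∀ {u} → Small u → ∀ m → Rich (u ++ a ^ m)
small-rich {u} (ext , r) m = rich-prefix (u ++ a ^ m) (subst Rich eq
  (gapRich-rich (u ++ a ^ M) (subst GapRich
    (map-extends refl stretch₃-suc u ext (sym (gapList-a^ M)))
    (gapRich-map (stretch-mono ≤-refl (m≤n+m 6 m)) _ r))))
  where
  M = m + 6
  eq : u ++ a ^ M ≡ (u ++ a ^ m) ++ a ^ 6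
  eq = trans (cong (u ++_) (power-+ a m 6)) (sym (++-assoc u (a ^ m) (a ^ 6)))

-- The sample with exponents 3 and 6 stands for all exponents k ≥ 3 and M ≥ k + 3, since
-- `stretch k M` sends 3 to k and 6 to M.
Large : Word → Word → Set
Large x p = Extends NotTwoFive p (a ^ 6) × Extends NotTwoFive x (a ^ 3 ++ b ∷ p ++ a ^ 6)
            × GapRich (gapList (x ++ a ^ 3 ++ b ∷ p ++ a ^ 6))

large-rich : ∀ {x p} → Large x p → ∀ k m → 3 ≤ k → Rich (x ++ a ^ k ++ b ∷ p ++ a ^ m)
large-rich {x} {p} (extp , extx , r) k m 3≤k = rich-prefix (x ++ a ^ k ++ b ∷ p ++ a ^ m) (subst Rich eq
  (gapRich-rich (x ++ a ^ k ++ b ∷ p ++ a ^ M) (subst GapRich gaps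
    (gapRich-map (stretch-mono 3≤k (m≤n+m (3 + k) m)) _ r))))
  where
  -- Large enough to lie above k, k + 1 and k + 2, the images of 3, 4 and 5; the surplus 3 + k is a
  -- suffix and is dropped at the end.
  M = m + (3 + k)
  f = stretch k M
  gaps-p : map f (gapList (p ++ a ^ 6)) ≡ gapList (p ++ a ^ M)
  gaps-p = map-extends refl stretch-suc p extp (sym (gapList-a^ M))
  gaps-k : map f (gapList (a ^ 3 ++ b ∷ p ++ a ^ 6)) ≡ gapList (a ^ k ++ b ∷ p ++ a ^ M)
  gaps-k = trans (cong₂ _∷_ (sym (+-identityʳ k)) gaps-p) (sym (gapList-power k (b ∷ p ++ a ^ M) refl))
  gaps : map f (gapList (x ++ a ^ 3 ++ b ∷ p ++ a ^ 6)) ≡ gapList (x ++ a ^ k ++ b ∷ p ++ a ^ M)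
  gaps = map-extends refl stretch-suc x extx gaps-k
  eq : x ++ a ^ k ++ b ∷ p ++ a ^ M ≡ (x ++ a ^ k ++ b ∷ p ++ a ^ m) ++ a ^ (3 + k)
  eq = trans (cong (λ u → x ++ a ^ k ++ b ∷ p ++ u) (power-+ a m (3 + k)))
             (regroup x (a ^ k) (b ∷ p) (a ^ m) (a ^ (3 + k)))
    where
    regroup : ∀ x u q v t → x ++ u ++ q ++ v ++ t ≡ (x ++ u ++ q ++ v) ++ t
    regroup x u q v t = solve (++-monoid Letter)

-- If `p` is empty, the two powers merge into one. Otherwise `p` has to begin with b, as all
-- non-empty prefixes of the tails below do, so that k and the leading part of `p` do not mix.
Uniform : Word → Word → Set
Uniform x []      = Small x
Uniform x (a ∷ p) = ⊥
Uniform x (b ∷ p) = Small (x ++ b ∷ p) × Small (x ++ a ∷ b ∷ p) × Small (x ++ a ∷ a ∷ b ∷ p) × Large x p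

small? : ∀ u → Dec (Small u)
small? u = extends? (λ g → ¬? (g ≟ 5)) u (a ^ 6) ×-dec gapRich? (gapList (u ++ a ^ 6))

large? : ∀ x p → Dec (Large x p)
large? x p = ext? p (a ^ 6) ×-dec ext? x (a ^ 3 ++ b ∷ p ++ a ^ 6)
             ×-dec gapRich? (gapList (x ++ a ^ 3 ++ b ∷ p ++ a ^ 6))
  where ext? = extends? (λ g → ¬? (g ≟ 2) ×-dec ¬? (g ≟ 5))

uniform? : ∀ x p → Dec (Uniform x p)
uniform? x []      = small? x
uniform? x (a ∷ p) = no λ ()
uniform? x (b ∷ p) = small? (x ++ b ∷ p) ×-dec small? (x ++ a ∷ b ∷ p) ×-dec small? (x ++ a ∷ a ∷ b ∷ p)
                     ×-dec large? x p

uniform-rich : ∀ x p → Uniform x p → ∀ k m → Rich (x ++ a ^ k ++ p ++ a ^ m)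
uniform-rich x []      s k m = subst (λ u → Rich (x ++ u)) (power-+ a k m) (small-rich s (k + m))
uniform-rich x (b ∷ p) (s₀ , s₁ , s₂ , large) 0 m = subst Rich (++-assoc x _ _) (small-rich s₀ m)
uniform-rich x (b ∷ p) (s₀ , s₁ , s₂ , large) 1 m = subst Rich (++-assoc x _ _) (small-rich s₁ m)
uniform-rich x (b ∷ p) (s₀ , s₁ , s₂ , large) 2 m = subst Rich (++-assoc x _ _) (small-rich s₂ m)
uniform-rich x (b ∷ p) (s₀ , s₁ , s₂ , large) k@(suc (suc (suc _))) m = large-rich large k m (s≤s (s≤s (s≤s z≤n)))

splits : Word → List (Word × Word)
splits []      = ([] , []) ∷ []
splits (x ∷ w) = ([] , x ∷ w) ∷ map (map₁ (x ∷_)) (splits w)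

∈-splits : ∀ p s → (p , s) ∈ splits (p ++ s)
∈-splits []      []      = here refl
∈-splits []      (_ ∷ _) = here refl
∈-splits (x ∷ p) s       = there (∈-map⁺ (map₁ (x ∷_)) (∈-splits p s))

UniformTail : Word → Set
UniformTail t = All (λ { (p , s) → All (λ x → Uniform x p) (reversals s) }) (splits t)

uniformTail? : ∀ t → Dec (UniformTail t)
uniformTail? t = all? (λ { (p , s) → all? (λ x → uniform? x p) (reversals s) }) (splits t)

power-split : ∀ C {s} n {t} → C ++ s ≡ a ^ n ++ t →
              (∃[ j ] ∃[ n′ ] (C ≡ a ^ j × s ≡ a ^ n′ ++ t)) ⊎ (∃[ p ] (C ≡ a ^ n ++ p × p ++ s ≡ t))
power-split []      n       eq = inj₁ (0 , n , refl , eq)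
power-split (c ∷ C) zero    eq = inj₂ (c ∷ C , refl , eq)
power-split (c ∷ C) (suc n) eq with ∷-injective eq
... | refl , eq′ with power-split C n eq′
...   | inj₁ (j , n′ , refl , e) = inj₁ (suc j , n′ , refl , e)
...   | inj₂ (p , refl , e)      = inj₂ (p , refl , e)

-- By induction over the blocks: a block inside a^n is appended to the final power a^m. The first
-- block leaving a^n contributes a^k and p, and the blocks after it reverse s to x and stand in
-- front.
reversal-power : ∀ {w v} → Reversal w v → ∀ n t → w ≡ a ^ n ++ t →
  ∃[ x ] ∃[ p ] ∃[ s ] ∃[ k ] ∃[ m ] (p ++ s ≡ t × Reversal s x × v ≡ x ++ a ^ k ++ p ++ a ^ m)
reversal-power [] zero [] _ = [] , [] , [] , 0 , 0 , refl , [] , refl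
reversal-power (step c B {s} {v} r) n t eq with power-split (c ∷ B) n eq
... | inj₂ (p , C≡ , e) = v , p , s , n , 0 , e , r ,
        cong (v ++_) (trans C≡ (cong (a ^ n ++_) (sym (++-identityʳ p))))
... | inj₁ (j , n′ , C≡ , e) with reversal-power r n′ t e
...   | x , p , s′ , k , m , e′ , r′ , refl = x , p , s′ , k , m + j , e′ , r′ ,
        trans (cong (_ ++_) C≡) (trans (regroup x (a ^ k) p (a ^ m) (a ^ j))
              (cong (λ u → x ++ a ^ k ++ p ++ u) (sym (power-+ a m j))))
  where
  regroup : ∀ x u q v t → (x ++ u ++ q ++ v) ++ t ≡ x ++ u ++ q ++ v ++ t
  regroup x u q v t = solve (++-monoid Letter)

allBRRich-power : ∀ t → UniformTail t → ∀ n → AllBRRich (a ^ n ++ t)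
allBRRich-power t uni n v v∈ with reversal-power (∈BR⇒reversal v∈) n t refl
... | x , p , s , k , m , refl , r , refl =
  uniform-rich x p (All.lookup (All.lookup uni (∈-splits p s)) (reversal∈reversals r)) k m

-- Sufficiency

tail₆ : Word
tail₆ = b ^ 1 ++ a ^ 1 ++ b ^ 1 ++ a ^ 1 ++ b ^ 1

uniform-tail₆ : UniformTail tail₆
uniform-tail₆ = toWitness {a? = uniformTail? tail₆} _

uniform-b³a : UniformTail (b ^ 3 ++ a ^ 1)
uniform-b³a = toWitness {a? = uniformTail? (b ^ 3 ++ a ^ 1)} _

uniform-b⁴a : UniformTail (b ^ 4 ++ a ^ 1)
uniform-b⁴a = toWitness {a? = uniformTail? (b ^ 4 ++ a ^ 1)} _

allBRRich-checked : ∀ w {_ : True (allReversalsRich? w)} → AllBRRich w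
allBRRich-checked w {check} = allReversalsRich⇒allBRRich (toWitness check)

allBRRich-uncomp : ∀ w → AllBRRich (comp w) → AllBRRich w
allBRRich-uncomp w h = subst AllBRRich (comp-involutive w) (allBRRich-comp h)

comp-power : ∀ x n w → comp (x ^ n ++ w) ≡ flipL x ^ n ++ comp w
comp-power x n w = trans (map-++ flipL (x ^ n) w) (cong (_++ comp w) (map-replicate flipL n x))

P8-sufficient : ∀ w → P8 w → AllBRRich w
P8-sufficient w refl = allBRRich-checked w

P7-sufficient : ∀ w → P7 w → AllBRRich w
P7-sufficient w (inj₁ refl)        = allBRRich-checked w
P7-sufficient w (inj₂ (inj₁ refl)) = allBRRich-checked w
P7-sufficient w (inj₂ (inj₂ refl)) = allBRRich-checked w

T-sufficient : ∀ w → T w → AllBRRich w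
T-sufficient w (inj₁ refl)                                    = allBRRich-checked w
T-sufficient w (inj₂ (inj₁ refl))                             = allBRRich-checked w
T-sufficient w (inj₂ (inj₂ (inj₁ refl)))                      = allBRRich-checked w
T-sufficient w (inj₂ (inj₂ (inj₂ (inj₁ refl))))               = allBRRich-checked w
T-sufficient w (inj₂ (inj₂ (inj₂ (inj₂ (inj₁ refl)))))        = allBRRich-checked w
T-sufficient w (inj₂ (inj₂ (inj₂ (inj₂ (inj₂ (inj₁ refl)))))) = allBRRich-checked w
T-sufficient w (inj₂ (inj₂ (inj₂ (inj₂ (inj₂ (inj₂ (n , _ , refl))))))) = allBRRich-power tail₆ uniform-tail₆ n

P6-sufficient : ∀ w → P6 w → AllBRRich w
P6-sufficient w (u , t , inj₁ refl) = T-sufficient u t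
P6-sufficient w (u , t , inj₂ refl) = allBRRich-reverse (allBRRich-comp (T-sufficient u t))

P5-sufficient : ∀ w → P5 w → AllBRRich w
P5-sufficient w (inj₁ (n₁ , n₃ , n₅ , _ , _ , _ , refl)) = allBRRich-≤2 (≤-reflexive
  (trans (bCount-power-++ n₁ _) (cong suc (trans (bCount-power-++ n₃ _) (cong suc (bCount-power n₅))))))
P5-sufficient w (inj₂ (1 , .3 , _ , _ , refl , inj₁ refl))        = allBRRich-checked w
P5-sufficient w (inj₂ (1 , .3 , _ , _ , refl , inj₂ (inj₁ refl))) = allBRRich-checked w
P5-sufficient w (inj₂ (1 , .3 , _ , _ , refl , inj₂ (inj₂ refl))) = allBRRich-checked w
P5-sufficient w (inj₂ (2 , .2 , _ , _ , refl , inj₁ refl))        = allBRRich-checked w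
P5-sufficient w (inj₂ (2 , .2 , _ , _ , refl , inj₂ (inj₁ refl))) = allBRRich-checked w
P5-sufficient w (inj₂ (2 , .2 , _ , _ , refl , inj₂ (inj₂ refl))) = allBRRich-checked w
P5-sufficient w (inj₂ (3 , .1 , _ , _ , refl , inj₁ refl))        = allBRRich-checked w
P5-sufficient w (inj₂ (3 , .1 , _ , _ , refl , inj₂ (inj₁ refl))) = allBRRich-checked w
P5-sufficient w (inj₂ (3 , .1 , _ , _ , refl , inj₂ (inj₂ refl))) = allBRRich-checked w
P5-sufficient w (inj₂ (4 , .0 , _ , () , refl , _))

P4-sufficient : ∀ w → P4 w → AllBRRich w
-- Here `a` is the rare letter; complementing gives a word with two b's.
P4-sufficient w (inj₁ (n₂ , n₄ , _ , _ , refl)) = allBRRich-uncomp w (allBRRich-≤2 (≤-reflexive (cong suc (begin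
  bCount (comp (b ^ n₂ ++ a ∷ b ^ n₄))    ≡⟨ cong bCount (comp-power b n₂ _) ⟩
  bCount (a ^ n₂ ++ b ∷ comp (b ^ n₄))    ≡⟨ bCount-power-++ n₂ _ ⟩
  suc (bCount (comp (b ^ n₄)))            ≡⟨ cong (λ u → suc (bCount u)) (map-replicate flipL n₄ b) ⟩
  suc (bCount (a ^ n₄))                   ≡⟨ cong suc (bCount-power n₄) ⟩
  1                                       ∎))))
  where open ≡-Reasoning
P4-sufficient w (inj₂ (inj₁ (n₁ , n₃ , _ , _ , refl))) = allBRRich-≤2 (≤-reflexive
  (trans (bCount-power-++ n₁ _) (cong suc (bCount-power-++ n₃ _))))
P4-sufficient w (inj₂ (inj₂ (_ , _ , _ , _ , p , q , refl))) = checked p q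
  where
  checked : ∀ {n₁ n₂ n₃ n₄} → Pair31 n₂ n₄ → Pair31 n₁ n₃ → AllBRRich (a ^ n₁ ++ b ^ n₂ ++ a ^ n₃ ++ b ^ n₄)
  checked (inj₁ (refl , refl))        (inj₁ (refl , refl))        = allBRRich-checked _
  checked (inj₁ (refl , refl))        (inj₂ (inj₁ (refl , refl))) = allBRRich-checked _
  checked (inj₁ (refl , refl))        (inj₂ (inj₂ (refl , refl))) = allBRRich-checked _
  checked (inj₂ (inj₁ (refl , refl))) (inj₁ (refl , refl))        = allBRRich-checked _
  checked (inj₂ (inj₁ (refl , refl))) (inj₂ (inj₁ (refl , refl))) = allBRRich-checked _
  checked (inj₂ (inj₁ (refl , refl))) (inj₂ (inj₂ (refl , refl))) = allBRRich-checked _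
  checked (inj₂ (inj₂ (refl , refl))) (inj₁ (refl , refl))        = allBRRich-checked _
  checked (inj₂ (inj₂ (refl , refl))) (inj₂ (inj₁ (refl , refl))) = allBRRich-checked _
  checked (inj₂ (inj₂ (refl , refl))) (inj₂ (inj₂ (refl , refl))) = allBRRich-checked _

P3-sufficient : ∀ w → P3 w → AllBRRich w
P3-sufficient w (inj₁ refl) = allBRRich-checked w
P3-sufficient w (inj₂ (inj₁ (n₂ , _ , refl))) = allBRRich-uncomp w (allBRRich-≤2 (≤-reflexive
  (cong suc (trans (cong bCount (comp-power b n₂ _)) (bCount-power-++ n₂ _)))))
P3-sufficient w (inj₂ (inj₂ (inj₁ (n₁ , n₃ , _ , _ , refl)))) = allBRRich-≤2 (≤-trans (≤-reflexive
  (trans (bCount-power-++ n₁ _) (cong suc (bCount-power n₃)))) (s≤s z≤n))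
P3-sufficient w (inj₂ (inj₂ (inj₂ (inj₁ (n₁ , n₃ , _ , _ , refl))))) = allBRRich-≤2 (≤-reflexive
  (trans (bCount-power-++ n₁ _) (cong (2 +_) (bCount-power n₃))))
-- The unbounded run is the last one, so the mirror image is treated by `allBRRich-power`.
P3-sufficient w (inj₂ (inj₂ (inj₂ (inj₂ (inj₁ (_ , n₃ , n₂∈ , _ , refl)))))) = reversed n₂∈
  where
  eq : ∀ t → reverse (a ^ n₃ ++ t) ≡ reverse t ++ a ^ n₃
  eq t = trans (reverse-++ (a ^ n₃) t) (cong (reverse t ++_) (reverse-power a n₃))
  reversed : ∀ {n₂} → n₂ ≡ 3 ⊎ n₂ ≡ 4 → AllBRRich (a ^ 1 ++ b ^ n₂ ++ a ^ n₃)
  reversed (inj₁ refl) = subst AllBRRich (eq (b ^ 3 ++ a ^ 1)) (allBRRich-reverse (allBRRich-power _ uniform-b³a n₃))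
  reversed (inj₂ refl) = subst AllBRRich (eq (b ^ 4 ++ a ^ 1)) (allBRRich-reverse (allBRRich-power _ uniform-b⁴a n₃))
P3-sufficient w (inj₂ (inj₂ (inj₂ (inj₂ (inj₂ (n₁ , _ , inj₁ refl , _ , refl)))))) = allBRRich-power _ uniform-b³a n₁
P3-sufficient w (inj₂ (inj₂ (inj₂ (inj₂ (inj₂ (n₁ , _ , inj₂ refl , _ , refl)))))) = allBRRich-power _ uniform-b⁴a n₁

characterise : ∀ {k P} (gs : List (GoodPattern P)) → AllCovered gs k → (∀ w → P w → AllBRRich w) → Case k P
characterise gs covered suff w _ long lw = mk⇔
  (necessary gs covered w long lw)
  [ suff w , (λ Pw → allBRRich-uncomp w (suff (comp w) Pw)) ]′

theorem4p21 : Case 8 P8 × Case 7 P7 × Case 6 P6 × Case 5 P5 × Case 4 P4 × Case 3 P3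
theorem4p21 =
    characterise goods8 covered8 P8-sufficient
  , characterise goods7 covered7 P7-sufficient
  , characterise goods6 covered6 P6-sufficient
  , characterise goods5 covered5 P5-sufficient
  , characterise goods4 covered4 P4-sufficient
  , characterise goods3 covered3 P3-sufficient
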